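{- Let $p$ be a prime and let $G_0$, $G_1$ and $G_2$ be pro-$p$ groups such that $\mathcal{R}_p(G_i)=0$ for $i=0,1,2$. If $G$ is one of the following groups, then $\mathcal{R}_p(G)=0$, and hence $G$ satisfies the $p$-Kijima--Nishi property: (i) $G$ is a proper amalgamated free pro-$p$ product $G=G_1\amalg_H G_2$ over a common subgroup $H$ of $G_1$ and $G_2$ such that the restriction maps $\mathrm{res}^1_{G_i,H}:\mathrm{H}^1(G_i,\mathbb{F}_p)\to \mathrm{H}^1(H,\mathbb{F}_p)$ are surjective for both $i=1,2$; (ii) $G$ is a proper pro-$p$ HNN-extension $G=\mathrm{HNN}(G_0,H,f)$ for a subgroup $H$ of $G_0$ and a monomorphism $f:H\to G_0$ such that the two maps $$f^\ast\circ\mathrm{res}^1_{G_0,f(H)},\ \mathrm{res}^1_{G_0,H}:\ \mathrm{H}^1(G_0,\mathbb{F}_p)\longrightarrow \mathrm{H}^1(H,\mathbb{F}_p)$$ are equal, where $f^\ast:\mathrm{H}^1(f(H),\mathbb{F}_p)\to \mathrm{H}^1(H,\mathbb{F}_p)$ is induced by $f$, and $\mathrm{res}^1_{G_0,H}$ is surjective.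
   Context: All subgroups of profinite groups are closed and all homomorphisms between them are continuous. For a profinite group $G$, $\mathrm{H}^n(G,\mathbb{F}_p)$ is continuous cohomology with trivial coefficients and $$\mathcal{R}_p(G)=\{\alpha\in \mathrm{H}^1(G,\mathbb{F}_p) : \alpha\smile\beta=0 \text{ for all }\beta\in \mathrm{H}^1(G,\mathbb{F}_p)\}.$$ For an open subgroup $U\le G$, corestriction maps $\mathcal{R}_p(U)$ into $\mathcal{R}_p(G)$, inducing $c_{U,G}:\mathcal{R}_p(U)\to\mathcal{R}_p(G)$. $G$ has the $p$-Kijima--Nishi property if $c_{U,G}$ is surjective for every open normal subgroup $U$ of index $p$. Amalgamated free pro-$p$ product: for pro-$p$ groups $G_1=\langle V_1\mid R_1\rangle$, $G_2=\langle V_2\mid R_2\rangle$ and injective continuous homomorphisms $f_i:H\to G_i$ from a pro-$p$ group $H$, $G_1\amalg_H G_2$ is the pro-$p$ group with pro-$p$ presentation $\langle V_1\cup V_2\mid R_1\cup R_2,\ f_1(h)=f_2(h)\ (h\in H)\rangle$. It is proper if the canonical maps $G_i\to G_1\amalg_H G_2$ are injective. Pro-$p$ HNN-extension: for a pro-$p$ group $G_0=\langle V\mid R\rangle$, a closed subgroup $H\subseteq G_0$ and an injective continuous homomorphism $f:H\to G_0$, $\mathrm{HNN}(G_0,H,f)$ is the pro-$p$ group with pro-$p$ presentation $\langle V,t\mid R,\ tht^{ -1}=f(h)\ (h\in H)\rangle$. It is proper if the canonical map $G_0\to \mathrm{HNN}(G_0,H,f)$ is injective.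
   Formalization: In case (ii) the subgroup H is additionally assumed nontrivial; for H = 1 the HNN-extension is the free pro-p product of G_0 and Z_p, and the class dual to the stable letter is a nonzero element of R_p(G), so the claim fails (e.g. G_0 = 1, G = Z_p). -}

module Defs where

open import Algebra.Bundles using (Group; CommutativeRing)
open import Algebra.Morphism.Structures using (module GroupMorphisms)
import Algebra.Properties.AbelianGroup as AbelianGroupProperties
import Algebra.Properties.CommutativeMonoid.Sum as CommutativeMonoidSum
import Algebra.Properties.Group as GroupProperties
open import Data.Empty using (⊥)
open import Data.Fin.Base using (Fin; zero; suc)
open import Data.Fin.Permutation using (Permutation′; permutation; _⟨$⟩ʳ_)
open import Data.Integer.Base as ℤ using (ℤ; +_)
open import Data.Integer.Divisibility.Signed as ℤ∣ using ()
import Data.Integer.Properties as ℤₚ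
open import Data.Integer.Tactic.RingSolver using (solve-∀)
open import Data.List.Base using (List; []; _∷_)
open import Data.List.Membership.Propositional using () renaming (_∈_ to _∈ˡ_)
open import Data.List.Relation.Unary.Any using (Any; here; there)
open import Data.Nat.Base as ℕ using (ℕ; zero; suc; _^_)
open import Data.Product.Base using (Σ; Σ-syntax; ∃; _×_; _,_; proj₁; proj₂)
open import Data.Sum.Base as Sum using (_⊎_; inj₁; inj₂)
open import Data.Unit.Base using (⊤; tt)
open import Data.Vec.Base as Vec using (Vec; []; _∷_)
open import Data.Vec.Relation.Binary.Pointwise.Inductive as Pw using (Pointwise; []; _∷_)
open import Data.Vec.Relation.Unary.All as All using (All; []; _∷_)
open import Function.Base using (_∘_; id)
open import Function.Bundles using (_⇔_; Equivalence)
open import Function.Definitions using (Injective; StrictlySurjective)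
open import Level using (Level; 0ℓ; Lift) renaming (suc to lsuc)
open import Relation.Binary.Core using (Rel)
open import Relation.Binary.Definitions using (_Respects_)
open import Relation.Binary.PropositionalEquality.Core as ≡ using (_≡_)
import Relation.Binary.Reasoning.Setoid as SetoidReasoning
open import Relation.Nullary.Negation.Core using (¬_)
open import Relation.Unary using (Pred; _∈_; _⊆_; _≐_; _∩_; ∁; U; ⋃)

private
  1ℓ : Level
  1ℓ = lsuc 0ℓ

record TopologicalGroup : Set₂ where
  field
    group : Group 0ℓ 0ℓ

  open Group group public hiding (_-_)

  field
    IsOpen       : Pred (Pred Carrier 0ℓ) 1ℓ
    open-resp-≈  : ∀ {P} → IsOpen P → P Respects _≈_
    open-resp-≐  : ∀ {P Q} → P ≐ Q → IsOpen P → IsOpen Q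
    open-U       : IsOpen U
    open-∩       : ∀ {P Q} → IsOpen P → IsOpen Q → IsOpen (P ∩ Q)
    open-⋃       : ∀ {I : Set} {P : I → Pred Carrier 0ℓ} →
                   (∀ i → IsOpen (P i)) → IsOpen (⋃ I P)
    ∙-continuous : ∀ {P} → IsOpen P → ∀ x y → P (x ∙ y) →
                   Σ[ Q ∈ Pred Carrier 0ℓ ] Σ[ R ∈ Pred Carrier 0ℓ ]
                     IsOpen Q × IsOpen R × Q x × R y ×
                     (∀ {a b} → Q a → R b → P (a ∙ b))
    ⁻¹-continuous : ∀ {P} → IsOpen P → IsOpen (λ x → P (x ⁻¹))

  IsClosed : Pred (Pred Carrier 0ℓ) 1ℓ
  IsClosed P = IsOpen (∁ P)

  IsCompact : Set₁
  IsCompact = ∀ {I : Set} (P : I → Pred Carrier 0ℓ) → (∀ i → IsOpen (P i)) →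
              (∀ x → ∃ λ i → P i x) →
              Σ[ is ∈ List I ] (∀ x → Any (λ i → P i x) is)

  IsHausdorff : Set₁
  IsHausdorff = ∀ x y → ¬ x ≈ y →
                Σ[ P ∈ Pred Carrier 0ℓ ] Σ[ Q ∈ Pred Carrier 0ℓ ]
                  IsOpen P × IsOpen Q × P x × Q y × (∀ {z} → P z → Q z → ⊥)

  record IsSubgroup (N : Pred Carrier 0ℓ) : Set where
    field
      resp-≈    : N Respects _≈_
      ε-closed  : N ε
      ∙-closed  : ∀ {x y} → N x → N y → N (x ∙ y)
      ⁻¹-closed : ∀ {x} → N x → N (x ⁻¹)

  IsNormal : Pred (Pred Carrier 0ℓ) 0ℓ
  IsNormal N = ∀ g {x} → N x → N (g ∙ x ∙ g ⁻¹)

  -- A numbering of the left cosets x N by Fin n, with a transversal.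
  record Index (N : Pred Carrier 0ℓ) (n : ℕ) : Set where
    field
      coset     : Carrier → Fin n
      rep       : Fin n → Carrier
      coset-rep : ∀ i → coset (rep i) ≡ i
      coset-≡   : ∀ x y → coset x ≡ coset y ⇔ N (x ⁻¹ ∙ y)

  ClosedNormalClosure : Pred Carrier 0ℓ → Pred Carrier 1ℓ
  ClosedNormalClosure R x = ∀ N → IsSubgroup N → IsNormal N → IsClosed N → R ⊆ N → N x

  locally-open : ∀ {P} →
                 (∀ x → P x → Σ[ Q ∈ Pred Carrier 0ℓ ] IsOpen Q × Q x × Q ⊆ P) →
                 IsOpen P
  locally-open {P} loc = open-resp-≐ (⊆P , P⊆) (open-⋃ λ (x , px) → proj₁ (proj₂ (loc x px)))
    where
    Q : ∃ P → Pred Carrier 0ℓ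
    Q (x , px) = proj₁ (loc x px)
    ⊆P : ⋃ (∃ P) Q ⊆ P
    ⊆P ((x , px) , q) = proj₂ (proj₂ (proj₂ (loc x px))) q
    P⊆ : P ⊆ ⋃ (∃ P) Q
    P⊆ {x} px = (x , px) , proj₁ (proj₂ (proj₂ (loc x px)))

  open-translateˡ : ∀ a {P} → IsOpen P → IsOpen (λ x → P (a ∙ x))
  open-translateˡ a op = locally-open λ x px →
    let _ , R , _ , oR , qa , rx , ⊆P = ∙-continuous op a x px in
    R , oR , rx , ⊆P qa

  open-translateʳ : ∀ a {P} → IsOpen P → IsOpen (λ x → P (x ∙ a))
  open-translateʳ a op = locally-open λ x px →
    let Q , _ , oQ , _ , qx , ra , ⊆P = ∙-continuous op x a px in
    Q , oQ , qx , λ q → ⊆P q ra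

  open-⋂ : ∀ {n} {P : Fin n → Pred Carrier 0ℓ} →
           (∀ i → IsOpen (P i)) → IsOpen (λ x → ∀ i → P i x)
  open-⋂ {zero}  op = open-resp-≐ ((λ _ ()) , _) open-U
  open-⋂ {suc n} op = open-resp-≐
    ((λ { (p₀ , p) zero → p₀ ; (p₀ , p) (suc i) → p i }) , λ p → p zero , p ∘ suc)
    (open-∩ (op zero) (open-⋂ (op ∘ suc)))

record ContinuousHom (G K : TopologicalGroup) : Set₁ where
  private
    module G = TopologicalGroup G
    module K = TopologicalGroup K
  field
    ⟦_⟧        : G.Carrier → K.Carrier
    isHom      : GroupMorphisms.IsGroupHomomorphism G.rawGroup K.rawGroup ⟦_⟧
    continuous : ∀ {P} → K.IsOpen P → G.IsOpen (P ∘ ⟦_⟧)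

  open GroupMorphisms.IsGroupHomomorphism isHom public using (⟦⟧-cong; homo; ε-homo; ⁻¹-homo)

  IsInjective : Set
  IsInjective = Injective G._≈_ K._≈_ ⟦_⟧

  IsSurjective : Set
  IsSurjective = StrictlySurjective K._≈_ ⟦_⟧

  image : Pred G.Carrier 0ℓ → Pred K.Carrier 0ℓ
  image P y = ∃ λ x → P x × ⟦ x ⟧ K.≈ y

open ContinuousHom public using (⟦_⟧; IsInjective)

infixr 9 _∘ᶜ_

_∘ᶜ_ : ∀ {F G K} → ContinuousHom G K → ContinuousHom F G → ContinuousHom F K
_∘ᶜ_ {F} {G} {K} ψ φ = record
  { ⟦_⟧        = ψ.⟦_⟧ ∘ φ.⟦_⟧
  ; isHom      = record
    { isMonoidHomomorphism = record
      { isMagmaHomomorphism = record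
        { isRelHomomorphism = record { cong = ψ.⟦⟧-cong ∘ φ.⟦⟧-cong }
        ; homo = λ x y → K.trans (ψ.⟦⟧-cong (φ.homo x y)) (ψ.homo _ _)
        }
      ; ε-homo = K.trans (ψ.⟦⟧-cong φ.ε-homo) ψ.ε-homo
      }
    ; ⁻¹-homo = λ x → K.trans (ψ.⟦⟧-cong (φ.⁻¹-homo x)) (ψ.⁻¹-homo _)
    }
  ; continuous = φ.continuous ∘ ψ.continuous
  }
  where
  module K = TopologicalGroup K
  module φ = ContinuousHom φ
  module ψ = ContinuousHom ψ

module _ (G : TopologicalGroup) where
  open TopologicalGroup G

  subgroup : (N : Pred Carrier 0ℓ) → IsSubgroup N → TopologicalGroup
  subgroup N isSubgroup = record
    { group = record
      { Carrier = ∃ N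
      ; _≈_     = λ x y → proj₁ x ≈ proj₁ y
      ; _∙_     = λ (x , nx) (y , ny) → x ∙ y , ∙-closed nx ny
      ; ε       = ε , ε-closed
      ; _⁻¹     = λ (x , nx) → x ⁻¹ , ⁻¹-closed nx
      ; isGroup = record
        { isMonoid = record
          { isSemigroup = record
            { isMagma = record
              { isEquivalence = record { refl = refl ; sym = sym ; trans = trans }
              ; ∙-cong = ∙-cong
              }
            ; assoc = λ _ _ _ → assoc _ _ _
            }
          ; identity = (λ _ → identityˡ _) , (λ _ → identityʳ _)
          }
        ; inverse = (λ _ → inverseˡ _) , (λ _ → inverseʳ _)
        ; ⁻¹-cong = ⁻¹-cong
        }
      }
    ; IsOpen = λ P → Σ[ Q ∈ Pred Carrier 0ℓ ] IsOpen Q × (P ≐ Q ∘ proj₁)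
    ; open-resp-≈ = λ (_ , oQ , P⊆ , ⊆P) x≈y px → ⊆P (open-resp-≈ oQ x≈y (P⊆ px))
    ; open-resp-≐ = λ (P⊆P′ , P′⊆P) (Q , oQ , P⊆ , ⊆P) → Q , oQ , P⊆ ∘ P′⊆P , P⊆P′ ∘ ⊆P
    ; open-U = U , open-U , _ , _
    ; open-∩ = λ (Q , oQ , P⊆ , ⊆P) (Q′ , oQ′ , P′⊆ , ⊆P′) →
        Q ∩ Q′ , open-∩ oQ oQ′
        , (λ (p , p′) → P⊆ p , P′⊆ p′) , (λ (q , q′) → ⊆P q , ⊆P′ q′)
    ; open-⋃ = λ {I} op →
        ⋃ I (λ i → proj₁ (op i)) , open-⋃ (λ i → proj₁ (proj₂ (op i)))
        , (λ (i , p) → i , proj₁ (proj₂ (proj₂ (op i))) p)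
        , (λ (i , q) → i , proj₂ (proj₂ (proj₂ (op i))) q)
    ; ∙-continuous = λ (Q , oQ , P⊆ , ⊆P) (x , _) (y , _) p →
        let A , B , oA , oB , ax , by , ⊆Q = ∙-continuous oQ x y (P⊆ p) in
        A ∘ proj₁ , B ∘ proj₁ , (A , oA , id , id) , (B , oB , id , id) , ax , by
        , λ a b → ⊆P (⊆Q a b)
    ; ⁻¹-continuous = λ (Q , oQ , P⊆ , ⊆P) → _ , ⁻¹-continuous oQ , P⊆ , ⊆P
    }
    where open IsSubgroup isSubgroup

  inclusion : ∀ {N} (isSubgroup : IsSubgroup N) → ContinuousHom (subgroup N isSubgroup) G
  inclusion _ = record
    { ⟦_⟧   = proj₁
    ; isHom = record
      { isMonoidHomomorphism = record
        { isMagmaHomomorphism = record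
          { isRelHomomorphism = record { cong = id }
          ; homo = λ _ _ → refl
          }
        ; ε-homo = refl
        }
      ; ⁻¹-homo = λ _ → refl
      }
    ; continuous = λ {P} oP → P , oP , id , id
    }

module _ {K G : TopologicalGroup} (φ : ContinuousHom K G) where
  private
    module K = TopologicalGroup K
    module G = TopologicalGroup G
    module φ = ContinuousHom φ

  image-isSubgroup : G.IsSubgroup (φ.image U)
  image-isSubgroup = record
    { resp-≈    = λ { x≈y (a , _ , e) → a , _ , G.trans e x≈y }
    ; ε-closed  = K.ε , _ , φ.ε-homo
    ; ∙-closed  = λ { (a , _ , e) (b , _ , e′) → a K.∙ b , _ , G.trans (φ.homo a b) (G.∙-cong e e′) }
    ; ⁻¹-closed = λ { (a , _ , e) → a K.⁻¹ , _ , G.trans (φ.⁻¹-homo a) (G.⁻¹-cong e) }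
    }

  imageSubgroup : TopologicalGroup
  imageSubgroup = subgroup G (φ.image U) image-isSubgroup

  toImage : ContinuousHom K imageSubgroup
  toImage = record
    { ⟦_⟧   = λ x → φ.⟦ x ⟧ , x , _ , G.refl
    ; isHom = record
      { isMonoidHomomorphism = record
        { isMagmaHomomorphism = record
          { isRelHomomorphism = record { cong = φ.⟦⟧-cong }
          ; homo = φ.homo
          }
        ; ε-homo = φ.ε-homo
        }
      ; ⁻¹-homo = φ.⁻¹-homo
      }
    ; continuous = λ (Q , oQ , P⊆ , ⊆P) → K.open-resp-≐ (⊆P , P⊆) (φ.continuous oQ)
    }

-- Equivalently, G is an inverse limit of finite p-groups.
record IsProP (p : ℕ) (G : TopologicalGroup) : Set₁ where
  open TopologicalGroup G
  field
    compact   : IsCompact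
    hausdorff : IsHausdorff
    basis     : ∀ {P} → IsOpen P → P ε →
                Σ[ N ∈ Pred Carrier 0ℓ ]
                  IsOpen N × IsSubgroup N × IsNormal N × (∃ λ k → Index N (p ^ k)) × N ⊆ P

record ProPGroup (p : ℕ) : Set₂ where
  field
    topologicalGroup : TopologicalGroup
    isProP           : IsProP p topologicalGroup

  open TopologicalGroup topologicalGroup public
  open IsProP isProP public

open ProPGroup public using (topologicalGroup)

-- Every open neighbourhood of 1 contains φ v for all but finitely many v.
ConvergesTo1 : (K : TopologicalGroup) {V : Set} → (V → TopologicalGroup.Carrier K) → Set₁
ConvergesTo1 K {V} φ =
  ∀ P → IsOpen P → P ε → Σ[ vs ∈ List V ] (∀ v → v ∈ˡ vs ⊎ P (φ v))
  where open TopologicalGroup K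

-- The free pro-p group on the set V converging to 1.
record FreeProP (p : ℕ) (V : Set) : Set₂ where
  field
    proPGroup   : ProPGroup p

  open ProPGroup proPGroup public

  field
    ι           : V → Carrier
    ι-converges : ConvergesTo1 (ProPGroup.topologicalGroup proPGroup) ι
    extend      : ∀ (K : ProPGroup p) (φ : V → ProPGroup.Carrier K) →
                  ConvergesTo1 (topologicalGroup K) φ →
                  ContinuousHom (ProPGroup.topologicalGroup proPGroup) (ProPGroup.topologicalGroup K)
    extend-ι    : ∀ K φ conv v → ProPGroup._≈_ K (⟦ extend K φ conv ⟧ (ι v)) (φ v)
    unique      : ∀ (K : ProPGroup p)
                  (ψ χ : ContinuousHom (ProPGroup.topologicalGroup proPGroup) (ProPGroup.topologicalGroup K)) →
                  (∀ v → ProPGroup._≈_ K (⟦ ψ ⟧ (ι v)) (⟦ χ ⟧ (ι v))) →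
                  ∀ x → ProPGroup._≈_ K (⟦ ψ ⟧ x) (⟦ χ ⟧ x)

-- π exhibits G as the topological quotient of the free pro-p group F by the
-- closed normal subgroup generated by R.
record IsPresentedBy {p : ℕ} {V : Set} (F : FreeProP p V)
                     (R : Pred (FreeProP.Carrier F) 0ℓ) (G : ProPGroup p)
                     (π : ContinuousHom (FreeProP.topologicalGroup F) (topologicalGroup G))
                     : Set₁ where
  private
    module F = FreeProP F
    module G = ProPGroup G
    module π = ContinuousHom π
  field
    surjective : π.IsSurjective
    openMap    : ∀ {P} → F.IsOpen P → G.IsOpen (π.image P)
    kernel     : ∀ w → (π.⟦ w ⟧ G.≈ G.ε) ⇔ F.ClosedNormalClosure R w

record Presentation {p : ℕ} (G : ProPGroup p) : Set₂ where
  field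
    V             : Set
    F             : FreeProP p V
    R             : Pred (FreeProP.Carrier F) 0ℓ
    π             : ContinuousHom (FreeProP.topologicalGroup F) (topologicalGroup G)
    isPresentedBy : IsPresentedBy F R G π

  open IsPresentedBy isPresentedBy public

module Descend {p : ℕ} {V : Set} {F : FreeProP p V} {R : Pred (FreeProP.Carrier F) 0ℓ}
               {G : ProPGroup p}
               {π : ContinuousHom (FreeProP.topologicalGroup F) (topologicalGroup G)}
               (presented : IsPresentedBy F R G π)
               (K : ProPGroup p)
               (ψ : ContinuousHom (FreeProP.topologicalGroup F) (topologicalGroup K))
               (kills : ∀ {r} → R r → ProPGroup._≈_ K (⟦ ψ ⟧ r) (ProPGroup.ε K))
               where
  private
    module F = FreeProP F
    module G = ProPGroup G
    module K = ProPGroup K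
    module π = ContinuousHom π
    module ψ = ContinuousHom ψ
    open IsPresentedBy presented
    open SetoidReasoning K.setoid

  private
    kerψ : Pred F.Carrier 0ℓ
    kerψ w = ψ.⟦ w ⟧ K.≈ K.ε

    kerψ-isSubgroup : F.IsSubgroup kerψ
    kerψ-isSubgroup = record
      { resp-≈    = λ x≈y e → K.trans (ψ.⟦⟧-cong (F.sym x≈y)) e
      ; ε-closed  = ψ.ε-homo
      ; ∙-closed  = λ e e′ → K.trans (ψ.homo _ _) (K.trans (K.∙-cong e e′) (K.identityˡ _))
      ; ⁻¹-closed = λ e → K.trans (ψ.⁻¹-homo _)
                            (K.trans (K.⁻¹-cong e) (GroupProperties.ε⁻¹≈ε K.group))
      }

    kerψ-isNormal : F.IsNormal kerψ
    kerψ-isNormal g {x} e = begin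
      ψ.⟦ g F.∙ x F.∙ g F.⁻¹ ⟧                   ≈⟨ ψ.homo _ _ ⟩
      ψ.⟦ g F.∙ x ⟧ K.∙ ψ.⟦ g F.⁻¹ ⟧             ≈⟨ K.∙-cong (ψ.homo _ _) (ψ.⁻¹-homo _) ⟩
      (ψ.⟦ g ⟧ K.∙ ψ.⟦ x ⟧) K.∙ ψ.⟦ g ⟧ K.⁻¹     ≈⟨ K.∙-congʳ (K.∙-congˡ e) ⟩
      (ψ.⟦ g ⟧ K.∙ K.ε) K.∙ ψ.⟦ g ⟧ K.⁻¹         ≈⟨ K.∙-congʳ (K.identityʳ _) ⟩
      ψ.⟦ g ⟧ K.∙ ψ.⟦ g ⟧ K.⁻¹                   ≈⟨ K.inverseʳ _ ⟩
      K.ε                                        ∎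

    kerψ-isClosed : F.IsClosed kerψ
    kerψ-isClosed = ψ.continuous {λ y → ¬ y K.≈ K.ε} (K.locally-open λ y y≉ε →
      let P , _ , oP , _ , py , qε , disj = K.hausdorff y K.ε y≉ε in
      P , oP , py , λ pz z≈ε → disj (K.open-resp-≈ oP z≈ε pz) qε)

    ker⊆ : ∀ {w} → π.⟦ w ⟧ G.≈ G.ε → ψ.⟦ w ⟧ K.≈ K.ε
    ker⊆ {w} e = Equivalence.to (kernel w) e kerψ
      kerψ-isSubgroup kerψ-isNormal kerψ-isClosed kills

    π≈⇒ψ≈ : ∀ {v w} → π.⟦ v ⟧ G.≈ π.⟦ w ⟧ → ψ.⟦ v ⟧ K.≈ ψ.⟦ w ⟧
    π≈⇒ψ≈ {v} {w} e = GroupProperties.x∙y⁻¹≈ε⇒x≈y K.group _ _ (begin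
      ψ.⟦ v ⟧ K.∙ ψ.⟦ w ⟧ K.⁻¹   ≈⟨ K.∙-congˡ (ψ.⁻¹-homo w) ⟨
      ψ.⟦ v ⟧ K.∙ ψ.⟦ w F.⁻¹ ⟧   ≈⟨ ψ.homo _ _ ⟨
      ψ.⟦ v F.∙ w F.⁻¹ ⟧         ≈⟨ ker⊆ (G.trans (π.homo _ _)
                                     (G.trans (G.∙-cong e (π.⁻¹-homo w)) (G.inverseʳ _))) ⟩
      K.ε                        ∎)

    lift : G.Carrier → F.Carrier
    lift x = proj₁ (surjective x)

    π-lift : ∀ x → π.⟦ lift x ⟧ G.≈ x
    π-lift x = proj₂ (surjective x)

  descend : ContinuousHom G.topologicalGroup K.topologicalGroup
  descend = record
    { ⟦_⟧   = λ x → ψ.⟦ lift x ⟧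
    ; isHom = record
      { isMonoidHomomorphism = record
        { isMagmaHomomorphism = record
          { isRelHomomorphism = record
            { cong = λ x≈y → π≈⇒ψ≈ (G.trans (π-lift _) (G.trans x≈y (G.sym (π-lift _)))) }
          ; homo = λ x y → K.trans
              (π≈⇒ψ≈ (G.trans (π-lift _)
                 (G.sym (G.trans (π.homo _ _) (G.∙-cong (π-lift x) (π-lift y))))))
              (ψ.homo _ _)
          }
        ; ε-homo = ker⊆ (π-lift _)
        }
      ; ⁻¹-homo = λ x → K.trans
          (π≈⇒ψ≈ (G.trans (π-lift _)
             (G.sym (G.trans (π.⁻¹-homo _) (G.⁻¹-cong (π-lift x))))))
          (ψ.⁻¹-homo _)
      }
    ; continuous = λ oP → G.open-resp-≐
        ( (λ { (w , pw , e) →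
             K.open-resp-≈ oP (π≈⇒ψ≈ (G.trans e (G.sym (π-lift _)))) pw })
        , (λ {x} px → lift x , px , π-lift x))
        (openMap (ψ.continuous oP))
    }

  descend-π : ∀ w → ⟦ descend ⟧ π.⟦ w ⟧ K.≈ ψ.⟦ w ⟧
  descend-π w = π≈⇒ψ≈ (π-lift _)

open Descend public using (descend; descend-π)

relator-trivial : ∀ {p V} {F : FreeProP p V} {R : Pred (FreeProP.Carrier F) 0ℓ}
                  {G : ProPGroup p} {π} → IsPresentedBy F R G π →
                  ∀ {w} → R w → ProPGroup._≈_ G (⟦ π ⟧ w) (ProPGroup.ε G)
relator-trivial presented {w} r =
  Equivalence.from (IsPresentedBy.kernel presented w) (λ _ _ _ _ R⊆N → R⊆N r)

module _ {p : ℕ} {V W : Set} (F : FreeProP p V) (E : FreeProP p W)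
         (f : V → W) (g : W → V ⊎ ⊤) (g∘f : ∀ v → g (f v) ≡ inj₁ v) where
  private
    module F = FreeProP F
    module E = FreeProP E

  private
    collect : List W → List V
    collect []       = []
    collect (w ∷ ws) with g w
    ... | inj₁ v = v ∷ collect ws
    ... | inj₂ _ = collect ws

    ∈-collect : ∀ {v} ws → f v ∈ˡ ws → v ∈ˡ collect ws
    ∈-collect {v} (w ∷ ws) (here ≡.refl) rewrite g∘f v = here ≡.refl
    ∈-collect {v} (w ∷ ws) (there m) with g w
    ... | inj₁ _ = there (∈-collect ws m)
    ... | inj₂ _ = ∈-collect ws m

    converges : ConvergesTo1 E.topologicalGroup (E.ι ∘ f)
    converges P oP pε =
      let ws , cofinite = E.ι-converges P oP pε in
      collect ws , λ v → Sum.map₁ (∈-collect ws) (cofinite (f v))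

  -- The homomorphism of free groups induced by an injection f : V → W of the
  -- generating sets (with partial inverse g).
  freeMap : ContinuousHom F.topologicalGroup E.topologicalGroup
  freeMap = F.extend E.proPGroup (E.ι ∘ f) converges

freeInj₁ : ∀ {p V W} (F : FreeProP p V) (E : FreeProP p (V ⊎ W)) →
           ContinuousHom (FreeProP.topologicalGroup F) (FreeProP.topologicalGroup E)
freeInj₁ F E = freeMap F E inj₁ (λ { (inj₁ v) → inj₁ v ; (inj₂ _) → inj₂ tt }) (λ _ → ≡.refl)

freeInj₂ : ∀ {p V W} (F : FreeProP p W) (E : FreeProP p (V ⊎ W)) →
           ContinuousHom (FreeProP.topologicalGroup F) (FreeProP.topologicalGroup E)
freeInj₂ F E = freeMap F E inj₂ (λ { (inj₁ _) → inj₂ tt ; (inj₂ v) → inj₁ v }) (λ _ → ≡.refl)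

module _ {p : ℕ} {H G₁ G₂ : ProPGroup p}
         (P₁ : Presentation G₁) (P₂ : Presentation G₂)
         (f₁ : ContinuousHom (topologicalGroup H) (topologicalGroup G₁))
         (f₂ : ContinuousHom (topologicalGroup H) (topologicalGroup G₂))
         where
  private
    module H  = ProPGroup H
    module G₁ = ProPGroup G₁
    module G₂ = ProPGroup G₂
    module P₁ = Presentation P₁
    module P₂ = Presentation P₂
    module F₁ = FreeProP P₁.F
    module F₂ = FreeProP P₂.F

  -- The relation f₁ h = f₂ h is imposed for all words w₁, w₂ representing its
  -- two sides.
  data AmalgamRelator (E : FreeProP p (P₁.V ⊎ P₂.V)) : Pred (FreeProP.Carrier E) 0ℓ where
    relator₁ : ∀ {r} → P₁.R r → AmalgamRelator E (⟦ freeInj₁ P₁.F E ⟧ r)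
    relator₂ : ∀ {r} → P₂.R r → AmalgamRelator E (⟦ freeInj₂ P₂.F E ⟧ r)
    identify : ∀ h {w₁ w₂} → ⟦ P₁.π ⟧ w₁ G₁.≈ ⟦ f₁ ⟧ h → ⟦ P₂.π ⟧ w₂ G₂.≈ ⟦ f₂ ⟧ h →
               AmalgamRelator E
                 (FreeProP._∙_ E (⟦ freeInj₁ P₁.F E ⟧ w₁)
                                 (FreeProP._⁻¹ E (⟦ freeInj₂ P₂.F E ⟧ w₂)))

  record Amalgam (G : ProPGroup p) : Set₂ where
    field
      E             : FreeProP p (P₁.V ⊎ P₂.V)
      π             : ContinuousHom (FreeProP.topologicalGroup E) (topologicalGroup G)
      isPresentedBy : IsPresentedBy E (AmalgamRelator E) G π

    canonical₁ : ContinuousHom (topologicalGroup G₁) (topologicalGroup G)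
    canonical₁ = descend P₁.isPresentedBy G (π ∘ᶜ freeInj₁ P₁.F E)
                   (relator-trivial isPresentedBy ∘ relator₁)

    canonical₂ : ContinuousHom (topologicalGroup G₂) (topologicalGroup G)
    canonical₂ = descend P₂.isPresentedBy G (π ∘ᶜ freeInj₂ P₂.F E)
                   (relator-trivial isPresentedBy ∘ relator₂)

    IsProper : Set
    IsProper = IsInjective canonical₁ × IsInjective canonical₂

module _ {p : ℕ} {G₀ : ProPGroup p} (P₀ : Presentation G₀)
         {H : Pred (ProPGroup.Carrier G₀) 0ℓ} (H≤G₀ : ProPGroup.IsSubgroup G₀ H)
         (f : ContinuousHom (subgroup (topologicalGroup G₀) H H≤G₀) (topologicalGroup G₀))
         where
  private
    module G₀ = ProPGroup G₀
    module P₀ = Presentation P₀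
    module F₀ = FreeProP P₀.F

  module _ (E : FreeProP p (P₀.V ⊎ ⊤)) where
    private
      module E = FreeProP E

    stableLetter : E.Carrier
    stableLetter = E.ι (inj₂ tt)

    data HNNRelator : Pred E.Carrier 0ℓ where
      relator  : ∀ {r} → P₀.R r → HNNRelator (⟦ freeInj₁ P₀.F E ⟧ r)
      identify : ∀ h {v w} → ⟦ P₀.π ⟧ v G₀.≈ proj₁ h → ⟦ P₀.π ⟧ w G₀.≈ ⟦ f ⟧ h →
                 HNNRelator
                   (stableLetter E.∙ ⟦ freeInj₁ P₀.F E ⟧ v E.∙ stableLetter E.⁻¹
                     E.∙ (⟦ freeInj₁ P₀.F E ⟧ w) E.⁻¹)

  record HNN (G : ProPGroup p) : Set₂ where
    field
      E             : FreeProP p (P₀.V ⊎ ⊤)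
      π             : ContinuousHom (FreeProP.topologicalGroup E) (topologicalGroup G)
      isPresentedBy : IsPresentedBy E (HNNRelator E) G π

    canonical : ContinuousHom (topologicalGroup G₀) (topologicalGroup G)
    canonical = descend P₀.isPresentedBy G (π ∘ᶜ freeInj₁ P₀.F E)
                  (relator-trivial isPresentedBy ∘ relator)

    IsProper : Set
    IsProper = IsInjective canonical

infix 4 _≡_[mod_]

record _≡_[mod_] (x y : ℤ) (n : ℕ) : Set where
  constructor congruent
  field
    n∣x-y : (+ n) ℤ∣.∣ (x ℤ.- y)

ℤ/_ : ℕ → CommutativeRing 0ℓ 0ℓ
ℤ/ n = record
  { Carrier = ℤ
  ; _≈_     = λ x y → x ≡ y [mod n ]
  ; _+_     = ℤ._+_
  ; _*_     = ℤ._*_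
  ; -_      = ℤ.-_
  ; 0#      = ℤ.0ℤ
  ; 1#      = ℤ.1ℤ
  ; isCommutativeRing = record
    { isRing = record
      { +-isAbelianGroup = record
        { isGroup = record
          { isMonoid = record
            { isSemigroup = record
              { isMagma = record
                { isEquivalence = record
                  { refl  = reflexive ≡.refl
                  ; sym   = λ {x} {y} (congruent d) →
                      congruent (≡.subst ((+ n) ℤ∣.∣_) (sym-lemma x y) (ℤ∣.∣m⇒∣-m d))
                  ; trans = λ {x} {y} {z} (congruent d) (congruent e) →
                      congruent (≡.subst ((+ n) ℤ∣.∣_) (trans-lemma x y z) (ℤ∣.∣m∣n⇒∣m+n d e))
                  }
                ; ∙-cong = λ {x} {y} {u} {v} (congruent d) (congruent e) →
                    congruent (≡.subst ((+ n) ℤ∣.∣_) (+-lemma x y u v) (ℤ∣.∣m∣n⇒∣m+n d e))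
                }
              ; assoc = λ x y z → reflexive (ℤₚ.+-assoc x y z)
              }
            ; identity = reflexive ∘ ℤₚ.+-identityˡ , reflexive ∘ ℤₚ.+-identityʳ
            }
          ; inverse = reflexive ∘ ℤₚ.+-inverseˡ , reflexive ∘ ℤₚ.+-inverseʳ
          ; ⁻¹-cong = λ {x} {y} (congruent d) →
              congruent (≡.subst ((+ n) ℤ∣.∣_) (neg-lemma x y) (ℤ∣.∣m⇒∣-m d))
          }
        ; comm = λ x y → reflexive (ℤₚ.+-comm x y)
        }
      ; *-cong = λ {x} {y} {u} {v} (congruent d) (congruent e) →
          congruent (≡.subst ((+ n) ℤ∣.∣_) (*-lemma x y u v)
            (ℤ∣.∣m∣n⇒∣m+n (ℤ∣.∣m⇒∣m*n u d) (ℤ∣.∣n⇒∣m*n y e)))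
      ; *-assoc = λ x y z → reflexive (ℤₚ.*-assoc x y z)
      ; *-identity = reflexive ∘ ℤₚ.*-identityˡ , reflexive ∘ ℤₚ.*-identityʳ
      ; distrib = (λ x y z → reflexive (ℤₚ.*-distribˡ-+ x y z))
                , (λ x y z → reflexive (ℤₚ.*-distribʳ-+ x y z))
      }
    ; *-comm = λ x y → reflexive (ℤₚ.*-comm x y)
    }
  }
  where
  reflexive : ∀ {x y} → x ≡ y → x ≡ y [mod n ]
  reflexive {x} ≡.refl = congruent (ℤ∣.divides ℤ.0ℤ (ℤₚ.+-inverseʳ x))

  sym-lemma : ∀ x y → ℤ.- (x ℤ.- y) ≡ y ℤ.- x
  sym-lemma = solve-∀

  trans-lemma : ∀ x y z → (x ℤ.- y) ℤ.+ (y ℤ.- z) ≡ x ℤ.- z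
  trans-lemma = solve-∀

  +-lemma : ∀ x y u v → (x ℤ.- y) ℤ.+ (u ℤ.- v) ≡ (x ℤ.+ u) ℤ.- (y ℤ.+ v)
  +-lemma = solve-∀

  neg-lemma : ∀ x y → ℤ.- (x ℤ.- y) ≡ (ℤ.- x) ℤ.- (ℤ.- y)
  neg-lemma = solve-∀

  *-lemma : ∀ x y u v → (x ℤ.- y) ℤ.* u ℤ.+ y ℤ.* (u ℤ.- v) ≡ (x ℤ.* u) ℤ.- (y ℤ.* v)
  *-lemma = solve-∀

-- Trivial coefficients in a ring k with the discrete topology.
module Cohomology (k : CommutativeRing 0ℓ 0ℓ) where
  private
    module k = CommutativeRing k
  open k using (_+_; _*_; _-_; 0#)
  open CommutativeMonoidSum k.+-commutativeMonoid using (sum; sum-cong-≋; sum-permute; ∑-distrib-+)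
  open SetoidReasoning k.setoid

  private
    x-0≈x : ∀ x → x - 0# k.≈ x
    x-0≈x x = k.trans (k.+-congˡ (GroupProperties.ε⁻¹≈ε k.+-group)) (k.+-identityʳ x)

    x+y-x≈y : ∀ x y → (x + y) - x k.≈ y
    x+y-x≈y = AbelianGroupProperties.xyx⁻¹≈y k.+-abelianGroup

  -- a₀ - (a₁ - (a₂ - ⋯)) = ∑ᵢ (-1)ⁱ aᵢ
  altSum : ∀ {n} → (Fin n → k.Carrier) → k.Carrier
  altSum {zero}  a = 0#
  altSum {suc n} a = a zero - altSum (a ∘ suc)

  altSum-cong : ∀ {n} {a b : Fin n → k.Carrier} → (∀ i → a i k.≈ b i) → altSum a k.≈ altSum b
  altSum-cong {zero}  e = k.refl
  altSum-cong {suc n} e = k.+-cong (e zero) (k.-‿cong (altSum-cong (e ∘ suc)))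

  altSum-0 : ∀ n → altSum {n} (λ _ → 0#) k.≈ 0#
  altSum-0 zero    = k.refl
  altSum-0 (suc n) = begin
    0# - altSum {n} (λ _ → 0#) ≈⟨ k.+-congˡ (k.-‿cong (altSum-0 n)) ⟩
    0# - 0#                    ≈⟨ k.-‿inverseʳ 0# ⟩
    0#                         ∎

  module _ (G : TopologicalGroup) where
    open TopologicalGroup G

    _≋_ : ∀ {n} → Rel (Vec Carrier n) 0ℓ
    _≋_ = Pointwise _≈_

    -- Inhomogeneous cochains, continuous for the product topology on Gⁿ.
    record Cochain (n : ℕ) : Set₁ where
      field
        fun        : Vec Carrier n → k.Carrier
        cong       : ∀ {xs ys} → xs ≋ ys → fun xs k.≈ fun ys
        continuous : ∀ xs → Σ[ Ps ∈ Vec (Pred Carrier 0ℓ) n ]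
                       All IsOpen Ps × Pointwise _∈_ xs Ps ×
                       (∀ {ys} → Pointwise _∈_ ys Ps → fun ys k.≈ fun xs)

    -- face i (g₀ , … , gₙ) is (g₁ , … , gₙ) for i = 0, (g₀ , … , gₙ₋₁) for
    -- i = n + 1, and multiplies gᵢ₋₁ and gᵢ otherwise.
    face : ∀ {n} → Fin (suc (suc n)) → Vec Carrier (suc n) → Vec Carrier n
    face         zero          (x ∷ xs)     = xs
    face {zero}  (suc _)       (x ∷ [])     = []
    face {suc n} (suc zero)    (x ∷ y ∷ xs) = x ∙ y ∷ xs
    face {suc n} (suc (suc i)) (x ∷ y ∷ xs) = x ∷ face (suc i) (y ∷ xs)

    d : ∀ {n} → (Vec Carrier n → k.Carrier) → Vec Carrier (suc n) → k.Carrier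
    d f xs = altSum (λ i → f (face i xs))

    IsCoboundary : ∀ {n} → (Vec Carrier n → k.Carrier) → Set₁
    IsCoboundary {zero}  f = Lift 1ℓ (∀ xs → f xs k.≈ 0#)
    IsCoboundary {suc n} f = Σ[ c ∈ Cochain n ] (∀ xs → f xs k.≈ d (Cochain.fun c) xs)

    -- Elements of Hⁿ(G, k) are represented by cocycles; equality is _∼_.
    record H (n : ℕ) : Set₁ where
      field
        cochain : Cochain n
      open Cochain cochain public
      field
        cocycle : ∀ xs → d fun xs k.≈ 0#

  module _ {G : TopologicalGroup} where
    open TopologicalGroup G

    infix 4 _∼_

    _∼_ : ∀ {n} → Rel (H G n) 1ℓ
    α ∼ β = IsCoboundary G (λ xs → H.fun α xs - H.fun β xs)

    0ᴴ : ∀ {n} → H G n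
    0ᴴ {n} = record
      { cochain = record
        { fun        = λ _ → 0#
        ; cong       = λ _ → k.refl
        ; continuous = λ xs → Vec.replicate n U , all-open n , all-∈ xs , λ _ → k.refl
        }
      ; cocycle = λ _ → altSum-0 (suc (suc n))
      }
      where
      all-open : ∀ n → All IsOpen (Vec.replicate n U)
      all-open zero    = []
      all-open (suc n) = open-U ∷ all-open n
      all-∈ : ∀ {n} (xs : Vec Carrier n) → Pointwise _∈_ xs (Vec.replicate n U)
      all-∈ []       = []
      all-∈ (x ∷ xs) = _ ∷ all-∈ xs

    additive : (α : H G 1) → ∀ x y →
               H.fun α (x ∙ y ∷ []) k.≈ H.fun α (x ∷ []) + H.fun α (y ∷ [])
    additive α x y = k.sym (begin
      a + b              ≈⟨ k.+-congˡ b≈c-a ⟩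
      a + (c - (a - 0#)) ≈⟨ k.+-congˡ (k.+-congˡ (k.-‿cong (x-0≈x a))) ⟩
      a + (c - a)        ≈⟨ k.+-assoc _ _ _ ⟨
      (a + c) - a        ≈⟨ x+y-x≈y a c ⟩
      c                  ∎)
      where
      a = H.fun α (x ∷ [])
      b = H.fun α (y ∷ [])
      c = H.fun α (x ∙ y ∷ [])
      b≈c-a : b k.≈ c - (a - 0#)
      b≈c-a = GroupProperties.x∙y⁻¹≈ε⇒x≈y k.+-group _ _ (H.cocycle α (x ∷ y ∷ []))

    infixl 7 _⌣_

    _⌣_ : H G 1 → H G 1 → H G 2
    _⌣_ α β = record
      { cochain = record { fun = fun ; cong = cong ; continuous = continuous }
      ; cocycle = cocycle
      }
      where
      module α = H α
      module β = H β
      fun : Vec Carrier 2 → k.Carrier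
      fun (x ∷ y ∷ []) = α.fun (x ∷ []) * β.fun (y ∷ [])
      cong : ∀ {xs ys} → _≋_ G xs ys → fun xs k.≈ fun ys
      cong (e ∷ e′ ∷ []) = k.*-cong (α.cong (e ∷ [])) (β.cong (e′ ∷ []))
      continuous : ∀ xs → Σ[ Ps ∈ Vec (Pred Carrier 0ℓ) 2 ]
                     All IsOpen Ps × Pointwise _∈_ xs Ps ×
                     (∀ {ys} → Pointwise _∈_ ys Ps → fun ys k.≈ fun xs)
      continuous (x ∷ y ∷ []) with α.continuous (x ∷ []) | β.continuous (y ∷ [])
      ... | P ∷ [] , oP ∷ [] , px ∷ [] , α≈ | Q ∷ [] , oQ ∷ [] , qy ∷ [] , β≈ =
        P ∷ Q ∷ [] , oP ∷ oQ ∷ [] , px ∷ qy ∷ []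
        , λ { (p ∷ q ∷ []) → k.*-cong (α≈ (p ∷ [])) (β≈ (q ∷ [])) }
      lemma : ∀ a b c e → b * e - ((a + b) * e - (a * (c + e) - (a * c - 0#))) k.≈ 0#
      lemma a b c e = begin
        b * e - ((a + b) * e - (a * (c + e) - (a * c - 0#)))
          ≈⟨ k.+-congˡ (k.-‿cong (k.+-cong (k.distribʳ e a b) (k.-‿cong ae≈))) ⟩
        b * e - ((a * e + b * e) - a * e)
          ≈⟨ k.+-congˡ (k.-‿cong (x+y-x≈y _ _)) ⟩
        b * e - b * e
          ≈⟨ k.-‿inverseʳ _ ⟩
        0# ∎
        where
        ae≈ : a * (c + e) - (a * c - 0#) k.≈ a * e
        ae≈ = k.trans (k.+-cong (k.distribˡ a c e) (k.-‿cong (x-0≈x _))) (x+y-x≈y _ _)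
      cocycle : ∀ xs → d G fun xs k.≈ 0#
      cocycle (x ∷ y ∷ z ∷ []) = k.trans
        (k.+-congˡ (k.-‿cong (k.+-cong (k.*-congʳ (additive α x y))
          (k.-‿cong (k.+-congʳ (k.*-congˡ (additive β y z)))))))
        (lemma _ _ _ _)

  module _ {G K : TopologicalGroup} (φ : ContinuousHom G K) where
    private
      module G = TopologicalGroup G
      module K = TopologicalGroup K
      module φ = ContinuousHom φ

      face-map : ∀ {n} i (xs : Vec G.Carrier (suc n)) →
                 _≋_ K (face K i (Vec.map φ.⟦_⟧ xs)) (Vec.map φ.⟦_⟧ (face G i xs))
      face-map         zero          (x ∷ xs)     = Pw.refl K.refl
      face-map {zero}  (suc _)       (x ∷ [])     = []
      face-map {suc n} (suc zero)    (x ∷ y ∷ xs) = K.sym (φ.homo x y) ∷ Pw.refl K.refl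
      face-map {suc n} (suc (suc i)) (x ∷ y ∷ xs) = K.refl ∷ face-map (suc i) (y ∷ xs)

      map-cong : ∀ {n} {xs ys : Vec G.Carrier n} → _≋_ G xs ys →
                 _≋_ K (Vec.map φ.⟦_⟧ xs) (Vec.map φ.⟦_⟧ ys)
      map-cong []       = []
      map-cong (e ∷ es) = φ.⟦⟧-cong e ∷ map-cong es

      preimages : ∀ {n} → Vec (Pred K.Carrier 0ℓ) n → Vec (Pred G.Carrier 0ℓ) n
      preimages = Vec.map (_∘ φ.⟦_⟧)

      preimages-open : ∀ {n} {Ps : Vec (Pred K.Carrier 0ℓ) n} → All K.IsOpen Ps → All G.IsOpen (preimages Ps)
      preimages-open []         = []
      preimages-open (oP ∷ oPs) = φ.continuous oP ∷ preimages-open oPs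

      ∈-preimages : ∀ {n} (xs : Vec G.Carrier n) (Ps : Vec (Pred K.Carrier 0ℓ) n) →
                    Pointwise _∈_ (Vec.map φ.⟦_⟧ xs) Ps → Pointwise _∈_ xs (preimages Ps)
      ∈-preimages []       []       []       = []
      ∈-preimages (x ∷ xs) (P ∷ Ps) (p ∷ ps) = p ∷ ∈-preimages xs Ps ps

      preimages-∈ : ∀ {n} (xs : Vec G.Carrier n) (Ps : Vec (Pred K.Carrier 0ℓ) n) →
                    Pointwise _∈_ xs (preimages Ps) → Pointwise _∈_ (Vec.map φ.⟦_⟧ xs) Ps
      preimages-∈ []       []       []       = []
      preimages-∈ (x ∷ xs) (P ∷ Ps) (p ∷ ps) = p ∷ preimages-∈ xs Ps ps

    pullback : ∀ {n} → H K n → H G n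
    pullback α = record
      { cochain = record
        { fun        = α.fun ∘ Vec.map φ.⟦_⟧
        ; cong       = α.cong ∘ map-cong
        ; continuous = λ xs →
            let Ps , oPs , xs∈ , const = α.continuous (Vec.map φ.⟦_⟧ xs) in
            preimages Ps , preimages-open oPs , ∈-preimages xs Ps xs∈
            , λ {ys} → const ∘ preimages-∈ ys Ps
        }
      ; cocycle = λ xs → k.trans
          (altSum-cong λ i → k.sym (α.cong (face-map i xs)))
          (α.cocycle (Vec.map φ.⟦_⟧ xs))
      }
      where module α = H α

  res : ∀ {G n} {N : Pred (TopologicalGroup.Carrier G) 0ℓ}
        (N≤G : TopologicalGroup.IsSubgroup G N) → H G n → H (subgroup G N N≤G) n
  res N≤G = pullback (inclusion _ N≤G)

  -- In degree 1, corestriction from an open subgroup is composition with the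
  -- transfer: cor α g = ∑ᵢ α(s_{g·i}⁻¹ g sᵢ), for (sᵢ) a transversal of the left
  -- cosets and g·i the coset of g sᵢ.
  module _ {G : TopologicalGroup} {N : Pred (TopologicalGroup.Carrier G) 0ℓ}
           (N≤G : TopologicalGroup.IsSubgroup G N) (N-open : TopologicalGroup.IsOpen G N)
           {n : ℕ} (index : TopologicalGroup.Index G N n)
           where
    open TopologicalGroup G
    open Index index
    private
      module N = IsSubgroup N≤G

      infixr 8 _·_
      _·_ : Carrier → Fin n → Fin n
      g · i = coset (g ∙ rep i)

      module _ {i j : Fin n} {g : Carrier} where
        toN : g · i ≡ j → N (rep j ⁻¹ ∙ (g ∙ rep i))
        toN e = Equivalence.to (coset-≡ _ _) (≡.trans (coset-rep j) (≡.sym e))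

        fromN : N (rep j ⁻¹ ∙ (g ∙ rep i)) → g · i ≡ j
        fromN m = ≡.trans (≡.sym (Equivalence.from (coset-≡ _ _) m)) (coset-rep j)

      coset-cong : ∀ {x y} → x ≈ y → coset x ≡ coset y
      coset-cong {x} {y} x≈y = Equivalence.from (coset-≡ x y)
        (N.resp-≈ (sym (trans (∙-congˡ (sym x≈y)) (inverseˡ x))) N.ε-closed)

      transfer : ∀ g i {j} → g · i ≡ j → ∃ N
      transfer g i {j} e = rep j ⁻¹ ∙ (g ∙ rep i) , toN e

      merge : ∀ g h i j l →
              (rep l ⁻¹ ∙ (g ∙ rep j)) ∙ (rep j ⁻¹ ∙ (h ∙ rep i)) ≈ rep l ⁻¹ ∙ ((g ∙ h) ∙ rep i)
      merge g h i j l = S.begin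
        (rep l ⁻¹ ∙ (g ∙ rep j)) ∙ (rep j ⁻¹ ∙ (h ∙ rep i))  S.≈⟨ assoc _ _ _ ⟩
        rep l ⁻¹ ∙ ((g ∙ rep j) ∙ (rep j ⁻¹ ∙ (h ∙ rep i)))  S.≈⟨ ∙-congˡ (assoc _ _ _) ⟩
        rep l ⁻¹ ∙ (g ∙ (rep j ∙ (rep j ⁻¹ ∙ (h ∙ rep i))))  S.≈⟨ ∙-congˡ (∙-congˡ (cancel _ _)) ⟩
        rep l ⁻¹ ∙ (g ∙ (h ∙ rep i))                         S.≈⟨ ∙-congˡ (assoc _ _ _) ⟨
        rep l ⁻¹ ∙ ((g ∙ h) ∙ rep i)                         S.∎
        where
        module S = SetoidReasoning setoid
        cancel : ∀ x y → x ∙ (x ⁻¹ ∙ y) ≈ y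
        cancel x y = trans (sym (assoc _ _ _)) (trans (∙-congʳ (inverseʳ x)) (identityˡ y))

      ·-∙ : ∀ g h i → g · h · i ≡ (g ∙ h) · i
      ·-∙ g h i = ≡.sym (fromN (N.resp-≈ (merge g h i _ _) (N.∙-closed (toN ≡.refl) (toN ≡.refl))))

      ·-ε : ∀ {g} → g ≈ ε → ∀ i → g · i ≡ i
      ·-ε e i = ≡.trans (coset-cong (trans (∙-congʳ e) (identityˡ _))) (coset-rep i)

      act : Carrier → Permutation′ n
      act g = permutation (g ·_) (g ⁻¹ ·_)
        (λ i → ≡.trans (·-∙ _ _ i) (·-ε (inverseʳ g) i))
        (λ i → ≡.trans (·-∙ _ _ i) (·-ε (inverseˡ g) i))

    module _ (α : H (subgroup G N N≤G) 1) where
      private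
        module α = H α

        α₁ : ∃ N → k.Carrier
        α₁ x = α.fun (x ∷ [])

        summand : Carrier → Fin n → k.Carrier
        summand g i = α₁ (transfer g i ≡.refl)

        summand-≈ : ∀ g i {j} (e : g · i ≡ j) (x : ∃ N) →
                    proj₁ x ≈ rep j ⁻¹ ∙ (g ∙ rep i) → summand g i k.≈ α₁ x
        summand-≈ g i ≡.refl x e = α.cong (sym e ∷ [])

        summand-∙ : ∀ g h i → summand (g ∙ h) i k.≈ summand g (h · i) + summand h i
        summand-∙ g h i = k.trans
          (summand-≈ (g ∙ h) i (≡.sym (·-∙ g h i))
            (_ , N.∙-closed (toN ≡.refl) (toN ≡.refl)) (merge g h i _ _))
          (additive α (transfer g (h · i) ≡.refl) (transfer h i ≡.refl))

      corFun : Vec Carrier 1 → k.Carrier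
      corFun (g ∷ []) = sum (summand g)

      private
        corFun-∙ : ∀ g h → corFun (g ∙ h ∷ []) k.≈ corFun (g ∷ []) + corFun (h ∷ [])
        corFun-∙ g h = begin
          sum (summand (g ∙ h))                            ≈⟨ sum-cong-≋ (summand-∙ g h) ⟩
          sum (λ i → summand g (h · i) + summand h i)      ≈⟨ ∑-distrib-+ (λ i → summand g (h · i)) (summand h) ⟩
          sum (λ i → summand g (h · i)) + sum (summand h)  ≈⟨ k.+-congʳ (sum-permute (summand g) (act h)) ⟨
          sum (summand g) + sum (summand h)                ∎

        corFun-cong : ∀ {xs ys} → _≋_ G xs ys → corFun xs k.≈ corFun ys
        corFun-cong {g ∷ []} {h ∷ []} (e ∷ []) = sum-cong-≋ λ i →
          summand-≈ g i (coset-cong (∙-congʳ e)) (transfer h i ≡.refl)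
            (∙-congˡ (∙-congʳ (sym e)))

        summand-continuous : ∀ g i → Σ[ P ∈ Pred Carrier 0ℓ ]
                             IsOpen P × P g × (∀ {h} → P h → summand h i k.≈ summand g i)
        summand-continuous g i with α.continuous (transfer g i ≡.refl ∷ [])
        ... | P ∷ [] , (Q , oQ , P⊆ , ⊆P) ∷ [] , p ∷ [] , const =
          (λ h → (N ∩ Q) (rep (g · i) ⁻¹ ∙ (h ∙ rep i)))
          , open-translateʳ (rep i) (open-translateˡ (rep (g · i) ⁻¹) (open-∩ N-open oQ))
          , (toN ≡.refl , P⊆ p)
          , λ {h} (m , q) → k.trans (summand-≈ h i (fromN m) (_ , m) refl) (const (⊆P q ∷ []))

      cor : H G 1
      cor = record
        { cochain = record
          { fun        = corFun
          ; cong       = corFun-cong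
          ; continuous = λ { (g ∷ []) →
              (λ h → ∀ i → proj₁ (summand-continuous g i) h) ∷ []
              , open-⋂ (λ i → proj₁ (proj₂ (summand-continuous g i))) ∷ []
              , (λ i → proj₁ (proj₂ (proj₂ (summand-continuous g i)))) ∷ []
              , λ { (ps ∷ []) → sum-cong-≋ λ i → proj₂ (proj₂ (proj₂ (summand-continuous g i))) (ps i) } }
          }
        ; cocycle = λ { (g ∷ h ∷ []) → k.trans
            (k.+-congˡ (k.-‿cong (k.+-congʳ (corFun-∙ g h)))) (lemma _ _) }
        }
        where
        lemma : ∀ a b → b - ((a + b) - (a - 0#)) k.≈ 0#
        lemma a b = k.trans
          (k.+-congˡ (k.-‿cong (k.trans (k.+-congˡ (k.-‿cong (x-0≈x a))) (x+y-x≈y a b))))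
          (k.-‿inverseʳ b)

module 𝔽-Cohomology (p : ℕ) where
  open Cohomology (ℤ/ p) public

  ℛ : (G : TopologicalGroup) → Pred (H G 1) 1ℓ
  ℛ G α = ∀ β → α ⌣ β ∼ 0ᴴ

  ℛ-Trivial : TopologicalGroup → Set₁
  ℛ-Trivial G = ∀ α → α ∈ ℛ G → α ∼ 0ᴴ

  KijimaNishi : TopologicalGroup → Set₁
  KijimaNishi G =
    ∀ {N : Pred Carrier 0ℓ} (N≤G : IsSubgroup N) (N-open : IsOpen N) →
    IsNormal N → (index : Index N p) →
    ∀ α → α ∈ ℛ G → Σ[ β ∈ H (subgroup G N N≤G) 1 ]
      β ∈ ℛ (subgroup G N N≤G) × cor N≤G N-open index β ∼ α
    where open TopologicalGroup G

{-# OPTIONS --safe #-}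
-- If restriction H¹(G) → H¹(G') is surjective, it maps ℛ(G) into ℛ(G'). Homomorphisms
-- to 𝔽ₚ that agree on H glue along the presentation of G, so this applies to the vertex
-- groups of both constructions, and a class α ∈ ℛ(G) vanishes on them. In case (i) this
-- forces α = 0. In case (ii) the only remaining value is α(t), t the stable letter. If
-- α ⌣ β = d c, then evaluating c on both sides of t h = f(h) t yields α(t) β(h) = 0 for
-- all h ∈ H. Every homomorphism H → 𝔽ₚ is the restriction of such a β, and one of them
-- is nonzero as H ≠ 1: H has a nontrivial finite quotient of order dividing a power of p,
-- and such a group has a nontrivial homomorphism to 𝔽ₚ. Hence α(t) = 0.
--
-- Membership in H is not decidable, so the last existence statement is only available
-- doubly negated; this suffices since α(t) = 0 is decidable.
module Submission where

open import Defs
open import Algebra.Bundles using (Group; CommutativeRing)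
open import Algebra.Core using (Op₁; Op₂)
import Algebra.Properties.CommutativeMonoid.Sum as CommutativeMonoidSum
import Algebra.Properties.Group as GroupProperties
open import Algebra.Structures using (IsGroup)
open import Data.Bool.Base using (if_then_else_)
open import Data.Fin.Base using (Fin; zero; suc; toℕ; fromℕ<; punchIn; punchOut; combine; finToFun; funToFin)
open import Data.Fin.Permutation using (permutation)
open import Data.Fin.Properties using (_≟_; any?; sequence; toℕ-injective; toℕ-fromℕ<; toℕ<n; punchIn-punchOut; punchOut-punchIn; punchOut-cong; punchInᵢ≢i; finToFun-funToFin; funToFin-finToFin)
open import Data.Integer.Base as ℤ using (ℤ; +_; _+_; _*_; _-_; -_; 0ℤ)
open import Data.Integer.DivMod using (_%ℕ_; _/ℕ_; n%ℕd<d; a≡a%ℕn+[a/ℕn]*n)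
import Data.Integer.Divisibility.Signed as ℤ∣
import Data.Integer.Properties as ℤₚ
open import Data.Integer.Tactic.RingSolver using (solve-∀)
open import Data.List.Base using (List; []; _∷_; _++_; map; filter; length; lookup; tabulate; allFin)
open import Data.List.Membership.Propositional using () renaming (_∈_ to _∈ˡ_)
open import Data.List.Membership.Propositional.Properties using (∈-filter⁺; ∈-filter⁻; ∈-allFin; ∈-lookup; ∈-++⁺ˡ; ∈-++⁺ʳ; ∈-map⁺)
open import Data.List.Relation.Unary.All as ListAll using ()
open import Data.List.Relation.Unary.AllPairs using (_∷_)
open import Data.List.Relation.Unary.Any using (here; there; index)
open import Data.List.Relation.Unary.Any.Properties using (lookup-index; tabulate⁺)
open import Data.List.Relation.Unary.Unique.Propositional using (Unique)
import Data.List.Relation.Unary.Unique.Propositional.Properties as Unique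
open import Data.Nat.Base as ℕ using (ℕ; zero; suc; _^_)
open import Data.Nat.Coprimality using (Coprime; coprime-divisor)
open import Data.Nat.Divisibility using (_∣_; _∣?_; _∣0; ∣-refl; ∣-reflexive; ∣-trans; ∣1⇒≡1; ∣m∣n⇒∣m+n; ∣m+n∣m⇒∣n; m∣m*n; >⇒∤)
open import Data.Nat.Primality using (Prime; prime⇒irreducible; prime⇒nonZero; ¬prime[1]; euclidsLemma)
import Data.Nat.Properties as ℕₚ
open import Data.Product.Base using (Σ-syntax; ∃; _×_; _,_; proj₁; proj₂)
open import Data.Sum.Base as Sum using (_⊎_; inj₁; inj₂)
open import Data.Unit.Base using (⊤; tt)
open import Data.Vec.Base using ([]; _∷_)
open import Data.Vec.Relation.Binary.Pointwise.Inductive using ([]; _∷_)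
open import Data.Vec.Relation.Unary.All using ([]; _∷_)
open import Effect.Monad using (RawMonad)
open import Function.Base using (_∘_; id)
open import Function.Bundles using (Equivalence; mk⇔)
open import Function.Definitions using (StrictlySurjective)
open import Level using (0ℓ; Lift; lift; lower) renaming (suc to lsuc)
open import Relation.Binary.Core using (Rel)
open import Relation.Binary.Definitions using (Decidable; _Respects_)
open import Relation.Binary.PropositionalEquality as ≡ using (_≡_; _≢_; refl; sym; trans; cong; cong₂; subst; module ≡-Reasoning)
import Relation.Binary.Reasoning.Setoid as SetoidReasoning
open import Relation.Binary.Structures using (IsEquivalence)
open import Relation.Nullary.Decidable using (Dec; yes; no; does; ¬?; map′; dec-true; dec-false; does-⇔; decidable-stable; ¬¬-excluded-middle)
open import Relation.Nullary.Negation using (contradiction; ¬¬-Monad)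
open import Relation.Nullary.Negation.Core using (¬_)
open import Relation.Unary using (Pred; _∈_)

open CommutativeMonoidSum ℕₚ.+-0-commutativeMonoid using (sum; sum-cong-≗; sum-permute; sum-remove; ∑-distrib-+; ∑-comm)

-- Counting by sums of indicators over `Fin n`.

𝟙 : {A : Set} → Dec A → ℕ
𝟙 a? = if does a? then 1 else 0

module _ {A : Set} (a? : Dec A) where
  𝟙-yes : A → 𝟙 a? ≡ 1
  𝟙-yes a rewrite dec-true a? a = refl

  𝟙-no : ¬ A → 𝟙 a? ≡ 0
  𝟙-no ¬a rewrite dec-false a? ¬a = refl

𝟙-⇔ : {A B : Set} (a? : Dec A) (b? : Dec B) → (A → B) → (B → A) → 𝟙 a? ≡ 𝟙 b?
𝟙-⇔ a? b? f g rewrite does-⇔ (mk⇔ f g) a? b? = refl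

sum-0 : ∀ {n} {f : Fin n → ℕ} → (∀ i → f i ≡ 0) → sum f ≡ 0
sum-0 {zero}  f≡0 = refl
sum-0 {suc n} f≡0 = cong₂ ℕ._+_ (f≡0 zero) (sum-0 (f≡0 ∘ suc))

sum-1 : ∀ n → sum {n} (λ _ → 1) ≡ n
sum-1 zero    = refl
sum-1 (suc n) = cong suc (sum-1 n)

sum-δ : ∀ {n} (i : Fin n) → sum (λ j → 𝟙 (i ≟ j)) ≡ 1
sum-δ {suc n} zero    = cong suc (sum-0 {n} λ _ → refl)
sum-δ         (suc i) = sum-δ i

sum-*ʳ : ∀ {n} (f : Fin n → ℕ) c → sum (λ i → f i ℕ.* c) ≡ sum f ℕ.* c
sum-*ʳ {zero}  f c = refl
sum-*ʳ {suc n} f c = trans (cong (f zero ℕ.* c ℕ.+_) (sum-*ʳ (f ∘ suc) c)) (sym (ℕₚ.*-distribʳ-+ c (f zero) _))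

sum≡0 : ∀ {n} {f : Fin n → ℕ} → sum f ≡ 0 → ∀ i → f i ≡ 0
sum≡0 {suc n} {f} e zero    = ℕₚ.m+n≡0⇒m≡0 (f zero) e
sum≡0 {suc n} {f} e (suc i) = sum≡0 (ℕₚ.m+n≡0⇒n≡0 (f zero) e) i

-- With the summand of `i` removed the remaining sum is 0, whereas a different `j` would contribute
-- 1 to it.
count≡1⇒unique : ∀ {n} {D : Fin n → Set} (D? : ∀ i → Dec (D i)) →
                 sum (λ i → 𝟙 (D? i)) ≡ 1 → ∀ {i j} → D i → D j → i ≡ j
count≡1⇒unique {suc n} {D} D? ∑≡1 {i} {j} di dj with i ≟ j
... | yes i≡j = i≡j
... | no  i≢j = contradiction (trans (sym 𝟙≡0) (𝟙-yes (D? _) (subst D (sym (punchIn-punchOut i≢j)) dj))) λ ()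
  where
  others≡0 : sum (λ l → 𝟙 (D? (punchIn i l))) ≡ 0
  others≡0 = ℕₚ.suc-injective (trans (cong (ℕ._+ sum (λ l → 𝟙 (D? (punchIn i l)))) (sym (𝟙-yes (D? i) di)))
    (trans (sym (sum-remove {i = i} (λ l → 𝟙 (D? l)))) ∑≡1))
  𝟙≡0 : 𝟙 (D? (punchIn i (punchOut i≢j))) ≡ 0
  𝟙≡0 = sum≡0 others≡0 (punchOut i≢j)

-- Induction on `n`, splitting off the class of `zero`. Arbitrary weights let that class be erased
-- by setting its weights to 0. Any other class is disjoint from it and keeps its sum, while the
-- erased class now sums to 0.
classes-∣ : ∀ {n d} {R : Rel (Fin n) 0ℓ} → IsEquivalence R → (R? : Decidable R) (w : Fin n → ℕ) →
            (∀ x → d ∣ sum (λ y → 𝟙 (R? x y) ℕ.* w y)) → d ∣ sum w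
classes-∣ {zero}  {d} _ _ _ _ = d ∣0
classes-∣ {suc n} {d} {R} R-equiv R? w d∣class =
  subst (d ∣_) (sym split) (∣m∣n⇒∣m+n (d∣class zero) (classes-∣ equiv′ (λ x y → R? (suc x) (suc y)) (w′ ∘ suc) d∣class′))
  where
  module R = IsEquivalence R-equiv

  -- w with the class of zero removed, to which the induction hypothesis applies.
  w′ : Fin (suc n) → ℕ
  w′ y = 𝟙 (¬? (R? zero y)) ℕ.* w y

  w′0 : w′ zero ≡ 0
  w′0 = cong (ℕ._* w zero) (𝟙-no (¬? (R? zero zero)) (λ ¬r → ¬r R.refl))

  equiv′ : IsEquivalence (λ x y → R (suc x) (suc y))
  equiv′ = record { refl = R.refl ; sym = R.sym ; trans = R.trans }

  split : sum w ≡ sum (λ y → 𝟙 (R? zero y) ℕ.* w y) ℕ.+ sum (w′ ∘ suc)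
  split = begin
    sum w
      ≡⟨ sum-cong-≗ pointwise ⟩
    sum (λ y → 𝟙 (R? zero y) ℕ.* w y ℕ.+ w′ y)
      ≡⟨ ∑-distrib-+ (λ y → 𝟙 (R? zero y) ℕ.* w y) w′ ⟩
    sum (λ y → 𝟙 (R? zero y) ℕ.* w y) ℕ.+ (w′ zero ℕ.+ sum (w′ ∘ suc))
      ≡⟨ cong (λ z → sum (λ y → 𝟙 (R? zero y) ℕ.* w y) ℕ.+ (z ℕ.+ sum (w′ ∘ suc))) w′0 ⟩
    sum (λ y → 𝟙 (R? zero y) ℕ.* w y) ℕ.+ sum (w′ ∘ suc) ∎
    where
    open ≡-Reasoning
    pointwise : ∀ y → w y ≡ 𝟙 (R? zero y) ℕ.* w y ℕ.+ w′ y
    pointwise y with R? zero y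
    ... | yes _ = trans (sym (ℕₚ.*-identityˡ (w y))) (sym (ℕₚ.+-identityʳ _))
    ... | no  _ = sym (ℕₚ.+-identityʳ (w y))

  class′ : ∀ x → sum (λ y → 𝟙 (R? (suc x) (suc y)) ℕ.* w′ (suc y)) ≡ sum (λ y → 𝟙 (R? (suc x) y) ℕ.* w′ y)
  class′ x = cong (ℕ._+ sum (λ y → 𝟙 (R? (suc x) (suc y)) ℕ.* w′ (suc y)))
    (sym (trans (cong (𝟙 (R? (suc x) zero) ℕ.*_) w′0) (ℕₚ.*-zeroʳ (𝟙 (R? (suc x) zero)))))

  d∣class′ : ∀ x → d ∣ sum (λ y → 𝟙 (R? (suc x) (suc y)) ℕ.* w′ (suc y))
  d∣class′ x rewrite class′ x with R? zero (suc x)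
  ... | yes r = subst (d ∣_) (sym (sum-0 vanish)) (d ∣0)
    where
    vanish : ∀ y → 𝟙 (R? (suc x) y) ℕ.* w′ y ≡ 0
    vanish y with R? (suc x) y
    ... | no  _ = refl
    ... | yes s = trans (ℕₚ.+-identityʳ _) (cong (ℕ._* w y) (𝟙-no (¬? (R? zero y)) λ ¬r → ¬r (R.trans r s)))
  ... | no ¬r = subst (d ∣_) (sum-cong-≗ same) (d∣class (suc x))
    where
    same : ∀ y → 𝟙 (R? (suc x) y) ℕ.* w y ≡ 𝟙 (R? (suc x) y) ℕ.* w′ y
    same y with R? (suc x) y
    ... | no  _ = refl
    ... | yes s = cong (1 ℕ.*_) (sym (trans
      (cong (ℕ._* w y) (𝟙-yes (¬? (R? zero y)) λ r → ¬r (R.trans r (R.sym s)))) (ℕₚ.*-identityˡ (w y))))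

-- If `p` does not divide `d`, then `d` is coprime to `p`, and the factors `p` can be cancelled one
-- at a time until `d` divides 1.
∣p^k⇒≡1⊎p∣ : ∀ {p d} → Prime p → ∀ k → d ∣ p ^ k → d ≡ 1 ⊎ p ∣ d
∣p^k⇒≡1⊎p∣ pr zero    d∣1 = inj₁ (∣1⇒≡1 d∣1)
∣p^k⇒≡1⊎p∣ {p} {d} pr (suc k) d∣ with p ∣? d
... | yes p∣d = inj₂ p∣d
... | no  p∤d = ∣p^k⇒≡1⊎p∣ pr k (coprime-divisor coprime d∣)
  where
  coprime : Coprime d p
  coprime (e∣d , e∣p) with prime⇒irreducible pr e∣p
  ... | inj₁ e≡1  = e≡1
  ... | inj₂ refl = contradiction e∣d p∤d

-- Finite groups on `Fin m`, their actions and orbit counting.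

module FiniteGroup {m} {_∙_ : Op₂ (Fin m)} {ε : Fin m} {_⁻¹ : Op₁ (Fin m)}
                   (isGroup : IsGroup _≡_ _∙_ ε _⁻¹) where

  group : Group 0ℓ 0ℓ
  group = record { isGroup = isGroup }

  open IsGroup isGroup public using (assoc; identityˡ; identityʳ; inverseˡ; inverseʳ)
  open GroupProperties group public

  sum-translate : ∀ g (f : Fin m → ℕ) → sum f ≡ sum (λ x → f (g ∙ x))
  sum-translate g f = sum-permute f (permutation (g ∙_) ((g ⁻¹) ∙_)
    (\\-leftDividesˡ g) (\\-leftDividesʳ g))

  module Action {N} (act : Fin m → Fin N → Fin N) (act-ε : ∀ x → act ε x ≡ x)
                (act-∙ : ∀ g h x → act g (act h x) ≡ act (g ∙ h) x) where

    Orbit : Rel (Fin N) 0ℓ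
    Orbit x y = ∃ λ g → act g x ≡ y

    Orbit? : Decidable Orbit
    Orbit? x y = any? λ g → act g x ≟ y

    act-injective : ∀ g {x y} → act g x ≡ act g y → x ≡ y
    act-injective g {x} {y} e = trans (sym (undo x)) (trans (cong (act (g ⁻¹)) e) (undo y))
      where
      undo : ∀ z → act (g ⁻¹) (act g z) ≡ z
      undo z = trans (act-∙ _ _ z) (trans (cong (λ h → act h z) (inverseˡ g)) (act-ε z))

    orbit-isEquivalence : IsEquivalence Orbit
    orbit-isEquivalence = record
      { refl  = ε , act-ε _
      ; sym   = λ { (g , refl) → (g ⁻¹) , trans (act-∙ _ _ _) (trans (cong (λ h → act h _) (inverseˡ g)) (act-ε _)) }
      ; trans = λ { (g , refl) (h , refl) → h ∙ g , sym (act-∙ h g _) }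
      }

    orbitSize : Fin N → ℕ
    orbitSize x = sum λ y → 𝟙 (Orbit? x y)

    stabiliserSize : Fin N → ℕ
    stabiliserSize x = sum λ g → 𝟙 (act g x ≟ x)

    -- Double counting of the pairs (g, y) with g x = y. Over a point g x of the orbit, translation
    -- by `g` identifies the fibre with the stabiliser, so all nonempty fibres have the same size.
    orbit-stabiliser : ∀ x → m ≡ orbitSize x ℕ.* stabiliserSize x
    orbit-stabiliser x = begin
      m                                               ≡⟨ sum-1 m ⟨
      sum {m} (λ _ → 1)                               ≡⟨ sum-cong-≗ (λ g → sum-δ (act g x)) ⟨
      sum (λ g → sum (λ y → 𝟙 (act g x ≟ y)))         ≡⟨ ∑-comm (λ g y → 𝟙 (act g x ≟ y)) ⟩
      sum (λ y → sum (λ g → 𝟙 (act g x ≟ y)))         ≡⟨ sum-cong-≗ fibre ⟩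
      sum (λ y → 𝟙 (Orbit? x y) ℕ.* stabiliserSize x) ≡⟨ sum-*ʳ (λ y → 𝟙 (Orbit? x y)) (stabiliserSize x) ⟩
      orbitSize x ℕ.* stabiliserSize x                ∎
      where
      open ≡-Reasoning
      fibre : ∀ y → sum (λ g → 𝟙 (act g x ≟ y)) ≡ 𝟙 (Orbit? x y) ℕ.* stabiliserSize x
      fibre y with Orbit? x y
      ... | no ¬o = sum-0 λ g → 𝟙-no (act g x ≟ y) λ e → ¬o (g , e)
      ... | yes (g , refl) = begin
        sum (λ h → 𝟙 (act h x ≟ act g x))        ≡⟨ sum-translate g (λ h → 𝟙 (act h x ≟ act g x)) ⟩
        sum (λ h → 𝟙 (act (g ∙ h) x ≟ act g x))  ≡⟨ sum-cong-≗ (λ h → 𝟙-⇔ (act (g ∙ h) x ≟ act g x) (act h x ≟ x)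
                                                       (λ e → act-injective g (trans (act-∙ g h x) e))
                                                       (λ e → trans (sym (act-∙ g h x)) (cong (act g) e))) ⟩
        stabiliserSize x                         ≡⟨ ℕₚ.*-identityˡ _ ⟨
        1 ℕ.* stabiliserSize x                   ∎

    -- If x₀ were the only fixed point, all other orbits would have size divisible by p,
    -- so N ≡ 1 (mod p).
    second-fixedPoint : ∀ {p} → Prime p → ∀ k → m ∣ p ^ k → p ∣ N →
                        ∀ x₀ → (∀ g → act g x₀ ≡ x₀) → ¬ (∀ x → (∀ g → act g x ≡ x) → x ≡ x₀)
    second-fixedPoint {p} pr k m∣p^k p∣N x₀ fixed₀ only =
      ¬prime[1] (subst Prime (∣1⇒≡1 (∣m+n∣m⇒∣n (subst (p ∣_) N≡ p∣N) p∣others)) pr)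
      where
      w : Fin N → ℕ
      w y = 𝟙 (¬? (x₀ ≟ y))

      N≡ : N ≡ sum w ℕ.+ 1
      N≡ = begin
        N                                  ≡⟨ sum-1 N ⟨
        sum {N} (λ _ → 1)                  ≡⟨ sum-cong-≗ complementary ⟩
        sum (λ y → w y ℕ.+ 𝟙 (x₀ ≟ y))     ≡⟨ ∑-distrib-+ w (λ y → 𝟙 (x₀ ≟ y)) ⟩
        sum w ℕ.+ sum (λ y → 𝟙 (x₀ ≟ y))   ≡⟨ cong (sum w ℕ.+_) (sum-δ x₀) ⟩
        sum w ℕ.+ 1                        ∎
        where
        open ≡-Reasoning
        complementary : ∀ y → 1 ≡ w y ℕ.+ 𝟙 (x₀ ≟ y)
        complementary y with x₀ ≟ y
        ... | yes _ = refl
        ... | no  _ = refl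

      -- By `orbit-stabiliser` the size of the orbit divides `p ^ k`. If it were 1, then `x` would
      -- be a fixed point other than `x₀`.
      p∣orbit : ∀ x → x₀ ≢ x → p ∣ orbitSize x
      p∣orbit x x₀≢x with ∣p^k⇒≡1⊎p∣ pr k (∣-trans
        (subst (orbitSize x ∣_) (sym (orbit-stabiliser x)) (m∣m*n (stabiliserSize x))) m∣p^k)
      ... | inj₂ p∣o = p∣o
      ... | inj₁ o≡1 = contradiction (sym (only x λ g →
        count≡1⇒unique (Orbit? x) o≡1 (g , refl) (ε , act-ε x))) x₀≢x

      p∣others : p ∣ sum w
      p∣others = classes-∣ orbit-isEquivalence Orbit? w p∣class
        where
        p∣class : ∀ x → p ∣ sum (λ y → 𝟙 (Orbit? x y) ℕ.* w y)
        p∣class x with x₀ ≟ x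
        ... | yes refl = subst (p ∣_) (sym (sum-0 vanish)) (p ∣0)
          where
          vanish : ∀ y → 𝟙 (Orbit? x₀ y) ℕ.* w y ≡ 0
          vanish y with Orbit? x₀ y
          ... | no  _       = refl
          ... | yes (g , e) = trans (ℕₚ.+-identityʳ _)
            (𝟙-no (¬? (x₀ ≟ y)) λ x₀≢y → x₀≢y (trans (sym (fixed₀ g)) e))
        ... | no x₀≢x = subst (p ∣_) (sum-cong-≗ keep) (p∣orbit x x₀≢x)
          where
          keep : ∀ y → 𝟙 (Orbit? x y) ≡ 𝟙 (Orbit? x y) ℕ.* w y
          keep y with Orbit? x y
          ... | no  _       = refl
          ... | yes (g , e) = sym (trans (ℕₚ.+-identityʳ _) (𝟙-yes (¬? (x₀ ≟ y)) λ x₀≡y →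
            x₀≢x (act-injective g (trans (fixed₀ g) (trans x₀≡y (sym e))))))

-- Nontrivial homomorphisms out of a finite `p`-group.

-- Hom(P, A) is the set of fixed points of P acting on the functions φ : P → A
-- with φ(1) = 1 by (g·φ)(x) = φ(xg) φ(g)⁻¹.
module _ {m q} {_∙_ : Op₂ (Fin (suc m))} {ε : Fin (suc m)} {_⁻¹ : Op₁ (Fin (suc m))}
         (P-isGroup : IsGroup _≡_ _∙_ ε _⁻¹)
         {_*ᴬ_ : Op₂ (Fin q)} {1ᴬ : Fin q} {_⁻¹ᴬ : Op₁ (Fin q)}
         (A-isGroup : IsGroup _≡_ _*ᴬ_ 1ᴬ _⁻¹ᴬ) where
  private
    module P = FiniteGroup P-isGroup
    module A = FiniteGroup A-isGroup

    -- A function with value `1ᴬ` at `ε` is encoded by its values at the other `m` elements, packed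
    -- into one number, so that the action is on some `Fin N` and `N` is visibly a power of `q`.
    Normalised : Set
    Normalised = Fin (q ^ m)

    ext : Normalised → Fin (suc m) → Fin q
    ext φ x with ε ≟ x
    ... | yes _   = 1ᴬ
    ... | no  ε≢x = finToFun φ (punchOut ε≢x)

    restrict : (Fin (suc m) → Fin q) → Normalised
    restrict ψ = funToFin (ψ ∘ punchIn ε)

    funToFin-cong : ∀ {r s} {f g : Fin r → Fin s} → (∀ i → f i ≡ g i) → funToFin f ≡ funToFin g
    funToFin-cong {zero}  e = refl
    funToFin-cong {suc r} e = cong₂ combine (e zero) (funToFin-cong (e ∘ suc))

    restrict-cong : ∀ {ψ χ} → (∀ x → ψ x ≡ χ x) → restrict ψ ≡ restrict χ
    restrict-cong e = funToFin-cong (e ∘ punchIn ε)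

    ext-ε : ∀ φ → ext φ ε ≡ 1ᴬ
    ext-ε φ with ε ≟ ε
    ... | yes _   = refl
    ... | no  ε≢ε = contradiction refl ε≢ε

    ext-restrict : ∀ ψ → ψ ε ≡ 1ᴬ → ∀ x → ext (restrict ψ) x ≡ ψ x
    ext-restrict ψ ψε x with ε ≟ x
    ... | yes refl = sym ψε
    ... | no  ε≢x  = trans (finToFun-funToFin (ψ ∘ punchIn ε) (punchOut ε≢x)) (cong ψ (punchIn-punchOut ε≢x))

    restrict-ext : ∀ φ → restrict (ext φ) ≡ φ
    restrict-ext φ = trans (funToFin-cong pointwise) (funToFin-finToFin {m} φ)
      where
      pointwise : ∀ i → ext φ (punchIn ε i) ≡ finToFun φ i
      pointwise i with ε ≟ punchIn ε i
      ... | yes e  = contradiction (sym e) (punchInᵢ≢i ε i)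
      ... | no  ne = cong (finToFun φ) (trans (punchOut-cong ε refl) (punchOut-punchIn ε))

    shift : Fin (suc m) → Normalised → Fin (suc m) → Fin q
    shift g φ x = ext φ (x ∙ g) *ᴬ (ext φ g ⁻¹ᴬ)

    act : Fin (suc m) → Normalised → Normalised
    act g φ = restrict (shift g φ)

    ext-act : ∀ g φ x → ext (act g φ) x ≡ shift g φ x
    ext-act g φ = ext-restrict (shift g φ)
      (trans (cong (λ y → ext φ y *ᴬ (ext φ g ⁻¹ᴬ)) (P.identityˡ g)) (A.inverseʳ _))

    act-ε : ∀ φ → act ε φ ≡ φ
    act-ε φ = trans (restrict-cong λ x → trans
      (cong₂ _*ᴬ_ (cong (ext φ) (P.identityʳ x)) (trans (cong _⁻¹ᴬ (ext-ε φ)) A.ε⁻¹≈ε)) (A.identityʳ _))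
      (restrict-ext φ)

    act-∙ : ∀ g h φ → act g (act h φ) ≡ act (g ∙ h) φ
    act-∙ g h φ = restrict-cong λ x → begin
      ext (act h φ) (x ∙ g) *ᴬ (ext (act h φ) g ⁻¹ᴬ)
        ≡⟨ cong₂ (λ a b → a *ᴬ (b ⁻¹ᴬ)) (ext-act h φ (x ∙ g)) (ext-act h φ g) ⟩
      (ext φ ((x ∙ g) ∙ h) *ᴬ c) *ᴬ ((ext φ (g ∙ h) *ᴬ c) ⁻¹ᴬ)
        ≡⟨ cancel _ _ c ⟩
      ext φ ((x ∙ g) ∙ h) *ᴬ (ext φ (g ∙ h) ⁻¹ᴬ)
        ≡⟨ cong (λ y → ext φ y *ᴬ (ext φ (g ∙ h) ⁻¹ᴬ)) (P.assoc x g h) ⟩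
      ext φ (x ∙ (g ∙ h)) *ᴬ (ext φ (g ∙ h) ⁻¹ᴬ) ∎
      where
      open ≡-Reasoning
      c = ext φ h ⁻¹ᴬ
      cancel : ∀ a b c → (a *ᴬ c) *ᴬ ((b *ᴬ c) ⁻¹ᴬ) ≡ a *ᴬ (b ⁻¹ᴬ)
      cancel a b c = begin
        (a *ᴬ c) *ᴬ ((b *ᴬ c) ⁻¹ᴬ)              ≡⟨ cong ((a *ᴬ c) *ᴬ_) (A.⁻¹-anti-homo-∙ b c) ⟩
        (a *ᴬ c) *ᴬ ((c ⁻¹ᴬ) *ᴬ (b ⁻¹ᴬ))        ≡⟨ A.assoc a c _ ⟩
        a *ᴬ (c *ᴬ ((c ⁻¹ᴬ) *ᴬ (b ⁻¹ᴬ)))        ≡⟨ cong (a *ᴬ_) (A.\\-leftDividesˡ c _) ⟩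
        a *ᴬ (b ⁻¹ᴬ)                            ∎

    -- Being fixed by `g` reads φ(x) = φ(xg) φ(g)⁻¹; it remains to multiply by φ(g) on the right.
    fixed⇒homo : ∀ φ → (∀ g → act g φ ≡ φ) → ∀ x g → ext φ (x ∙ g) ≡ ext φ x *ᴬ ext φ g
    fixed⇒homo φ fixed x g = sym (trans
      (cong (_*ᴬ ext φ g) (trans (cong (λ χ → ext χ x) (sym (fixed g))) (ext-act g φ x)))
      (A.//-rightDividesˡ (ext φ g) (ext φ (x ∙ g))))

  -- The constant function is a fixed point, and `p` divides the number `q ^ m` of normalised
  -- functions, so it cannot be the only one. The element `x ≢ ε` is what guarantees a positive
  -- exponent `m`.
  nontrivial-homo : ∀ {p k} → Prime p → suc m ∣ p ^ k → p ∣ q → ∀ {x : Fin (suc m)} → x ≢ ε →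
                    ¬ (∀ φ → (∀ x y → φ (x ∙ y) ≡ φ x *ᴬ φ y) → ∀ x → φ x ≡ 1ᴬ)
  nontrivial-homo {p} {k} pr m∣p^k p∣q {x} x≢ε trivial =
    P.Action.second-fixedPoint act act-ε act-∙ pr k m∣p^k (p∣q^m x≢ε) φ₀ fixed₀ λ φ fixed →
      trans (sym (restrict-ext φ)) (restrict-cong (trivial (ext φ) (fixed⇒homo φ fixed)))
    where
    φ₀ : Normalised
    φ₀ = restrict λ _ → 1ᴬ

    fixed₀ : ∀ g → act g φ₀ ≡ φ₀
    fixed₀ g = restrict-cong λ x → trans
      (cong₂ (λ a b → a *ᴬ (b ⁻¹ᴬ)) (ext-restrict _ refl (x ∙ g)) (ext-restrict _ refl g)) (A.inverseʳ 1ᴬ)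

    p∣q^m : ∀ {n} {x y : Fin (suc n)} → x ≢ y → p ∣ q ^ n
    p∣q^m {zero}  {zero} {zero} x≢y = contradiction refl x≢y
    p∣q^m {suc n}               _   = ∣-trans p∣q (m∣m*n (q ^ n))

-- The quotient by a normal subgroup of finite index, as a group on the coset numbers.

module FiniteQuotient (G : TopologicalGroup) {N : Pred (TopologicalGroup.Carrier G) 0ℓ}
                      (N≤G : TopologicalGroup.IsSubgroup G N) (N-normal : TopologicalGroup.IsNormal G N)
                      {n : ℕ} (ix : TopologicalGroup.Index G N n) where
  open TopologicalGroup G hiding (isEquivalence)
    renaming (refl to ≈-refl; sym to ≈-sym; trans to ≈-trans)
  open Index ix public
  open GroupProperties group
  private module N = IsSubgroup N≤G

  coset-≡⇒N : ∀ {x y} → coset x ≡ coset y → N (x ⁻¹ ∙ y)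
  coset-≡⇒N = Equivalence.to (coset-≡ _ _)

  N⇒coset-≡ : ∀ {x y} → N (x ⁻¹ ∙ y) → coset x ≡ coset y
  N⇒coset-≡ = Equivalence.from (coset-≡ _ _)

  coset-cong : ∀ {x y} → x ≈ y → coset x ≡ coset y
  coset-cong x≈y = N⇒coset-≡ (N.resp-≈ (≈-sym (≈-trans (∙-congʳ (⁻¹-cong x≈y)) (inverseˡ _))) N.ε-closed)

  -- The quotient of the two products is the conjugate of x⁻¹x′ by y⁻¹, times y⁻¹y′; normality puts
  -- both factors in `N`.
  coset-∙-cong : ∀ {x x′ y y′} → coset x ≡ coset x′ → coset y ≡ coset y′ → coset (x ∙ y) ≡ coset (x′ ∙ y′)
  coset-∙-cong {x} {x′} {y} {y′} e f = N⇒coset-≡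
    (N.resp-≈ eq (N.∙-closed (N-normal (y ⁻¹) (coset-≡⇒N e)) (coset-≡⇒N f)))
    where
    open import Relation.Binary.Reasoning.Setoid (TopologicalGroup.setoid G)
    eq : (y ⁻¹ ∙ (x ⁻¹ ∙ x′) ∙ y ⁻¹ ⁻¹) ∙ (y ⁻¹ ∙ y′) ≈ (x ∙ y) ⁻¹ ∙ (x′ ∙ y′)
    eq = begin
      (y ⁻¹ ∙ (x ⁻¹ ∙ x′) ∙ y ⁻¹ ⁻¹) ∙ (y ⁻¹ ∙ y′)   ≈⟨ assoc _ _ _ ⟩
      y ⁻¹ ∙ (x ⁻¹ ∙ x′) ∙ (y ⁻¹ ⁻¹ ∙ (y ⁻¹ ∙ y′))   ≈⟨ ∙-congˡ (\\-leftDividesʳ (y ⁻¹) y′) ⟩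
      y ⁻¹ ∙ (x ⁻¹ ∙ x′) ∙ y′                        ≈⟨ ∙-congʳ (assoc _ _ _) ⟨
      y ⁻¹ ∙ x ⁻¹ ∙ x′ ∙ y′                          ≈⟨ assoc _ _ _ ⟩
      y ⁻¹ ∙ x ⁻¹ ∙ (x′ ∙ y′)                        ≈⟨ ∙-congʳ (⁻¹-anti-homo-∙ x y) ⟨
      (x ∙ y) ⁻¹ ∙ (x′ ∙ y′)                         ∎

  coset-⁻¹-cong : ∀ {x y} → coset x ≡ coset y → coset (x ⁻¹) ≡ coset (y ⁻¹)
  coset-⁻¹-cong {x} {y} e = N⇒coset-≡ (N.resp-≈ eq (N.⁻¹-closed (N-normal y (coset-≡⇒N e))))
    where
    open import Relation.Binary.Reasoning.Setoid (TopologicalGroup.setoid G)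
    eq : (y ∙ (x ⁻¹ ∙ y) ∙ y ⁻¹) ⁻¹ ≈ x ⁻¹ ⁻¹ ∙ y ⁻¹
    eq = begin
      (y ∙ (x ⁻¹ ∙ y) ∙ y ⁻¹) ⁻¹   ≈⟨ ⁻¹-cong (∙-congʳ (assoc _ _ _)) ⟨
      ((y ∙ x ⁻¹) ∙ y ∙ y ⁻¹) ⁻¹   ≈⟨ ⁻¹-cong (//-rightDividesʳ y (y ∙ x ⁻¹)) ⟩
      (y ∙ x ⁻¹) ⁻¹                ≈⟨ ⁻¹-anti-homo-∙ y (x ⁻¹) ⟩
      x ⁻¹ ⁻¹ ∙ y ⁻¹               ∎

  infixl 7 _∙ᶠ_
  _∙ᶠ_ : Op₂ (Fin n)
  i ∙ᶠ j = coset (rep i ∙ rep j)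

  εᶠ : Fin n
  εᶠ = coset ε

  infix 8 _⁻¹ᶠ
  _⁻¹ᶠ : Op₁ (Fin n)
  i ⁻¹ᶠ = coset (rep i ⁻¹)

  coset-∙ : ∀ x y → coset (x ∙ y) ≡ coset x ∙ᶠ coset y
  coset-∙ x y = coset-∙-cong (sym (coset-rep _)) (sym (coset-rep _))

  coset-⁻¹ : ∀ x → coset (x ⁻¹) ≡ coset x ⁻¹ᶠ
  coset-⁻¹ x = coset-⁻¹-cong (sym (coset-rep _))

  isGroupᶠ : IsGroup _≡_ _∙ᶠ_ εᶠ _⁻¹ᶠ
  isGroupᶠ = record
    { isMonoid = record
      { isSemigroup = record
        { isMagma = record { isEquivalence = ≡.isEquivalence ; ∙-cong = cong₂ _∙ᶠ_ }
        ; assoc = λ i j k → trans (coset-∙-cong (coset-rep _) refl) (trans (coset-cong (assoc _ _ _))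
                    (coset-∙-cong refl (sym (coset-rep _))))
        }
      ; identity = (λ i → trans (coset-∙-cong (coset-rep _) refl) (trans (coset-cong (identityˡ _)) (coset-rep i)))
                 , (λ i → trans (coset-∙-cong refl (coset-rep _)) (trans (coset-cong (identityʳ _)) (coset-rep i)))
      }
    ; inverse = (λ i → trans (coset-∙-cong (coset-rep _) refl) (coset-cong (inverseˡ _)))
              , (λ i → trans (coset-∙-cong refl (coset-rep _)) (coset-cong (inverseʳ _)))
    ; ⁻¹-cong = cong _⁻¹ᶠ
    }

-- The index of N ∩ H in H, for N normal of finite index.

length-filter-tabulate : ∀ {n} {A : Set} {D : A → Set} (D? : ∀ a → Dec (D a)) (f : Fin n → A) →
                         length (filter D? (tabulate f)) ≡ sum (λ i → 𝟙 (D? (f i)))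
length-filter-tabulate {zero}  D? f = refl
length-filter-tabulate {suc n} D? f with D? (f zero)
... | yes _ = cong suc (length-filter-tabulate D? (f ∘ suc))
... | no  _ = length-filter-tabulate D? (f ∘ suc)

-- In a list without repetitions a value occurs at one position only. This makes positions usable as
-- coset numbers.
index-lookup : ∀ {A : Set} {xs : List A} → Unique xs → ∀ {i x} (x∈xs : x ∈ˡ xs) → x ≡ lookup xs i → index x∈xs ≡ i
index-lookup (_ ∷ _)    {zero}  (here _)     _    = refl
index-lookup (x# ∷ _)   {suc i} (here refl)  x≡   = contradiction x≡ (ListAll.lookup x# (∈-lookup i))
index-lookup (x# ∷ _)   {zero}  (there x∈xs) refl = contradiction refl (ListAll.lookup x# x∈xs)
index-lookup (_ ∷ xs!)  {suc i} (there x∈xs) x≡   = cong suc (index-lookup xs! x∈xs x≡)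

module _ (G : TopologicalGroup) {N : Pred (TopologicalGroup.Carrier G) 0ℓ}
         (N≤G : TopologicalGroup.IsSubgroup G N) (N-normal : TopologicalGroup.IsNormal G N)
         {n : ℕ} (ix : TopologicalGroup.Index G N n)
         {H : Pred (TopologicalGroup.Carrier G) 0ℓ} (H≤G : TopologicalGroup.IsSubgroup G H) where
  open TopologicalGroup G using (Carrier; IsSubgroup; _∙_; ε; _⁻¹)
  private
    module H = IsSubgroup H≤G
    module Q = FiniteQuotient G N≤G N-normal ix
    module QG = FiniteGroup Q.isGroupᶠ

    -- The image of H in G/N; the three closure properties that follow make it a subgroup.
    Meets : Fin n → Set
    Meets i = Σ[ h ∈ Carrier ] H h × Q.coset h ≡ i

    meets-∙ : ∀ {i j} → Meets i → Meets j → Meets (i Q.∙ᶠ j)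
    meets-∙ (x , hx , refl) (y , hy , refl) = x ∙ y , H.∙-closed hx hy , Q.coset-∙ x y

    meets-⁻¹ : ∀ {i} → Meets i → Meets (i Q.⁻¹ᶠ)
    meets-⁻¹ (x , hx , refl) = x ⁻¹ , H.⁻¹-closed hx , Q.coset-⁻¹ x

    meets-ε : Meets Q.εᶠ
    meets-ε = ε , H.ε-closed , refl

  -- Cosets of N ∩ H in H correspond to elements of the image of H in G/N. Once that image is
  -- decidable it can be listed, and each entry comes with a representative in H.
  subgroup-index : (∀ i → Dec (Meets i)) →
                   Σ[ m ∈ ℕ ] TopologicalGroup.Index (subgroup G H H≤G) (N ∘ proj₁) m × m ∣ n
  subgroup-index meets? = m , record
    { coset     = λ (x , hx) → index (∈S x hx)
    ; rep       = λ i → proj₁ (met i) , proj₁ (proj₂ (met i))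
    ; coset-rep = λ i → index-lookup S! (∈S _ _) (proj₂ (proj₂ (met i)))
    ; coset-≡   = λ (x , hx) (y , hy) → mk⇔
        (λ e → Q.coset-≡⇒N (trans (lookup-index (∈S x hx))
                 (trans (cong (lookup S) e) (sym (lookup-index (∈S y hy))))))
        (λ xN → index-lookup S! (∈S x hx) (trans (Q.N⇒coset-≡ xN) (lookup-index (∈S y hy))))
    } , m∣n
    where
    S : List (Fin n)
    S = filter meets? (allFin n)

    m = length S

    S! : Unique S
    S! = Unique.filter⁺ meets? (Unique.allFin⁺ n)

    ∈S : ∀ x → H x → Q.coset x ∈ˡ S
    ∈S x hx = ∈-filter⁺ meets? (∈-allFin _) (x , hx , refl)

    met : ∀ i → Meets (lookup S i)
    met i = proj₂ (∈-filter⁻ meets? {xs = allFin n} (∈-lookup i))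

    -- Lagrange: all cosets of the image of H in G/N have size m.
    m∣n : m ∣ n
    m∣n = subst (m ∣_) (sum-1 n) (classes-∣
      {R = λ i j → Meets (i Q.⁻¹ᶠ Q.∙ᶠ j)}
      (record
        { refl  = λ {i} → subst Meets (sym (QG.inverseˡ i)) meets-ε
        ; sym   = λ {i} {j} r → subst Meets (trans (QG.⁻¹-anti-homo-∙ _ j) (cong (j Q.⁻¹ᶠ Q.∙ᶠ_) (QG.⁻¹-involutive i))) (meets-⁻¹ r)
        ; trans = λ {i} {j} {k} r s → subst Meets
            (trans (QG.assoc (i Q.⁻¹ᶠ) j _) (cong (i Q.⁻¹ᶠ Q.∙ᶠ_) (QG.\\-leftDividesˡ j k))) (meets-∙ r s)
        })
      (λ i j → meets? (i Q.⁻¹ᶠ Q.∙ᶠ j)) (λ _ → 1)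
      λ i → ∣-reflexive (begin
        m                                                    ≡⟨ length-filter-tabulate meets? (λ j → j) ⟩
        sum (λ j → 𝟙 (meets? j))                             ≡⟨ QG.sum-translate (i Q.⁻¹ᶠ) (λ j → 𝟙 (meets? j)) ⟩
        sum (λ j → 𝟙 (meets? (i Q.⁻¹ᶠ Q.∙ᶠ j)))              ≡⟨ sum-cong-≗ {n} (λ j → ℕₚ.*-identityʳ (𝟙 (meets? (i Q.⁻¹ᶠ Q.∙ᶠ j)))) ⟨
        sum (λ j → 𝟙 (meets? (i Q.⁻¹ᶠ Q.∙ᶠ j)) ℕ.* 1)        ∎))
      where open ≡-Reasoning

  -- Only `n` instances of excluded middle are required, and finitely many doubly negated statements
  -- can be combined into one.
  ¬¬-subgroup-index : ¬ ¬ (Σ[ m ∈ ℕ ] TopologicalGroup.Index (subgroup G H H≤G) (N ∘ proj₁) m × m ∣ n)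
  ¬¬-subgroup-index ¬∃ = sequence (RawMonad.rawApplicative ¬¬-Monad) (λ _ → ¬¬-excluded-middle) (¬∃ ∘ subgroup-index)

-- The additive group of ℤ/p as a discrete pro-p group.

∣b-a⇒≡ : ∀ {p a b} → a ℕ.≤ b → b ℕ.< p → p ∣ ℤ.∣ + b ℤ.- + a ∣ → a ≡ b
∣b-a⇒≡ {p} {a} {b} a≤b b<p d with b ℕ.∸ a in eq
  | ≡.subst (p ∣_) (≡.trans (≡.cong ℤ.∣_∣ (ℤₚ.m-n≡m⊖n b a)) (≡.cong ℤ.∣_∣ (ℤₚ.⊖-≥ a≤b))) d
... | zero  | _  = ℕₚ.≤-antisym a≤b (ℕₚ.m∸n≡0⇒m≤n eq)
... | suc _ | d′ = contradiction d′ (>⇒∤ (ℕₚ.≤-<-trans (≡.subst (ℕ._≤ b) eq (ℕₚ.m∸n≤m b a)) b<p))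

residue-unique : ∀ {p a b} → a ℕ.< p → b ℕ.< p → + a ≡ + b [mod p ] → a ≡ b
residue-unique {p} {a} {b} a<p b<p (congruent d) with ℕₚ.≤-total a b
... | inj₁ a≤b = ∣b-a⇒≡ a≤b b<p (≡.subst (p ∣_) (ℤₚ.∣i-j∣≡∣j-i∣ (+ a) (+ b)) (ℤ∣.∣⇒∣ᵤ d))
... | inj₂ b≤a = ≡.sym (∣b-a⇒≡ b≤a a<p (ℤ∣.∣⇒∣ᵤ d))

module CyclicGroup (p : ℕ) (pr : Prime p) where
  private
    instance
      p≢0 : ℕ.NonZero p
      p≢0 = prime⇒nonZero pr

  module k = CommutativeRing (ℤ/ p)

  -- Elements are integers up to congruence, so the open sets of the discrete topology are the
  -- predicates that respect congruence mod `p`.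
  discrete : TopologicalGroup
  discrete = record
    { group         = k.+-group
    ; IsOpen        = λ P → Lift (lsuc 0ℓ) (P Respects k._≈_)
    ; open-resp-≈   = lower
    ; open-resp-≐   = λ (P⊆Q , Q⊆P) (lift resp) → lift λ e q → P⊆Q (resp e (Q⊆P q))
    ; open-U        = lift _
    ; open-∩        = λ (lift r) (lift s) → lift λ e (x , y) → r e x , s e y
    ; open-⋃        = λ opens → lift λ e (i , x) → i , lower (opens i) e x
    ; ∙-continuous  = λ (lift resp) x y pxy → (x k.≈_) , (y k.≈_)
        , lift (λ e f → k.trans f e) , lift (λ e f → k.trans f e) , k.refl , k.refl
        , λ e f → resp (k.+-cong e f) pxy
    ; ⁻¹-continuous = λ (lift resp) → lift λ e → resp (k.-‿cong e)
    }

  private module D = TopologicalGroup discrete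

  zeros : Pred ℤ 0ℓ
  zeros = k._≈ k.0#

  zeros-isSubgroup : D.IsSubgroup zeros
  zeros-isSubgroup = record
    { resp-≈    = λ e f → k.trans (k.sym e) f
    ; ε-closed  = k.refl
    ; ∙-closed  = λ e f → k.trans (k.+-cong e f) (k.+-identityˡ _)
    ; ⁻¹-closed = λ e → k.trans (k.-‿cong e) (GroupProperties.ε⁻¹≈ε k.+-group)
    }

  zeros-isNormal : D.IsNormal zeros
  zeros-isNormal g e = k.trans (k.+-congʳ {k.- g} (k.trans (k.+-congˡ {g} e) (k.+-identityʳ g))) (k.-‿inverseʳ g)

  residue : ℤ → Fin p
  residue x = fromℕ< (n%ℕd<d x p)

  ≈-residue : ∀ x → x k.≈ + toℕ (residue x)
  ≈-residue x = k.trans x≈x%p (k.reflexive (≡.cong +_ (≡.sym (toℕ-fromℕ< (n%ℕd<d x p)))))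
    where
    lemma : ∀ r m → (r ℤ.+ m) ℤ.- r ≡ m
    lemma = solve-∀

    x≈x%p : x k.≈ + (x %ℕ p)
    x≈x%p = congruent (ℤ∣.divides (x /ℕ p)
      (≡.trans (≡.cong (ℤ._- + (x %ℕ p)) (a≡a%ℕn+[a/ℕn]*n x p)) (lemma (+ (x %ℕ p)) (x /ℕ p ℤ.* + p))))

  residue-index : D.Index zeros p
  residue-index = record
    { coset     = residue
    ; rep       = λ i → + toℕ i
    ; coset-rep = λ i → residue-≡ (+ toℕ i) i k.refl
    ; coset-≡   = λ x y → mk⇔
        (λ e → k.trans (k.+-congˡ {k.- x} (k.trans (≈-residue y)
          (k.trans (k.reflexive (≡.cong (+_ ∘ toℕ) (≡.sym e))) (k.sym (≈-residue x))))) (k.-‿inverseˡ x))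
        (λ e → residue-≡ x (residue y) (k.trans
          (k.sym (GroupProperties.x∙y⁻¹≈ε⇒x≈y k.+-group y x (k.trans (k.+-comm y (k.- x)) e))) (≈-residue y)))
    }
    where
    residue-≡ : ∀ x i → x k.≈ + toℕ i → residue x ≡ i
    residue-≡ x i e = toℕ-injective (residue-unique (toℕ<n _) (toℕ<n i) (k.trans (k.sym (≈-residue x)) e))

  proPGroup : ProPGroup p
  proPGroup = record
    { topologicalGroup = discrete
    ; isProP = record
      -- The finite subcover consists of one member of the cover for each of the `p` residues.
      { compact   = λ P opens cover → tabulate (λ i → proj₁ (cover (rep i))) , λ x →
          tabulate⁺ {P = λ i → P i x} (residue x) (lower (opens _) (k.sym (≈-residue x)) (proj₂ (cover (rep (residue x)))))
      ; hausdorff = λ x y x≉y → (x k.≈_) , (y k.≈_)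
          , lift (λ e f → k.trans f e) , lift (λ e f → k.trans f e) , k.refl , k.refl
          , λ e f → x≉y (k.trans e (k.sym f))
      ; basis     = λ (lift resp) p0 → zeros , lift (λ e f → k.trans (k.sym e) f) , zeros-isSubgroup , zeros-isNormal
          , (1 , ≡.subst (D.Index zeros) (≡.sym (ℕₚ.*-identityʳ p)) residue-index) , λ e → resp (k.sym e) p0
      }
    }
    where open D.Index residue-index using (rep)

  ≈0? : ∀ x → Dec (x k.≈ k.0#)
  ≈0? x = map′ (λ d → congruent (≡.subst (+ p ℤ∣.∣_) (≡.sym (ℤₚ.+-identityʳ x)) d))
               (λ (congruent d) → ≡.subst (+ p ℤ∣.∣_) (ℤₚ.+-identityʳ x) d) ((+ p) ℤ∣.∣? x)

  zeroDivisor : ∀ {x y} → x k.* y k.≈ k.0# → x k.≈ k.0# ⊎ y k.≈ k.0#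
  zeroDivisor {x} {y} (congruent d) = Sum.map from from
    (euclidsLemma ℤ.∣ x ∣ ℤ.∣ y ∣ pr (≡.subst (p ∣_) (ℤₚ.abs-* x y)
      (ℤ∣.∣⇒∣ᵤ (≡.subst (+ p ℤ∣.∣_) (ℤₚ.+-identityʳ (x ℤ.* y)) d))))
    where
    from : ∀ {z} → p ∣ ℤ.∣ z ∣ → z k.≈ k.0#
    from {z} d = congruent (≡.subst (+ p ℤ∣.∣_) (≡.sym (ℤₚ.+-identityʳ z)) (ℤ∣.∣ᵤ⇒∣ d))

-- Constructing continuous homomorphisms and families converging to 1.

module _ {G K : TopologicalGroup} where
  private
    module G = TopologicalGroup G
    module K = TopologicalGroup K

  continuousHom : (φ : G.Carrier → K.Carrier) → (∀ {x y} → x G.≈ y → φ x K.≈ φ y) →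
                  (∀ x y → φ (x G.∙ y) K.≈ φ x K.∙ φ y) →
                  (∀ {P} → K.IsOpen P → G.IsOpen (P ∘ φ)) → ContinuousHom G K
  continuousHom φ cong homo continuous = record
    { ⟦_⟧ = φ
    ; isHom = record
      { isMonoidHomomorphism = record
        { isMagmaHomomorphism = record { isRelHomomorphism = record { cong = cong } ; homo = homo }
        ; ε-homo = ε-homo
        }
      ; ⁻¹-homo = λ x → GroupProperties.inverseˡ-unique K.group _ _
          (K.trans (K.sym (homo _ _)) (K.trans (cong (G.inverseˡ x)) ε-homo))
      }
    ; continuous = continuous
    }
    where
    ε-homo : φ G.ε K.≈ K.ε
    ε-homo = GroupProperties.identityʳ-unique K.group _ _
      (K.trans (K.sym (homo _ _)) (cong (G.identityʳ G.ε)))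

  trivialHom : ContinuousHom G K
  trivialHom = continuousHom (λ _ → K.ε) (λ _ → K.refl) (λ _ _ → K.sym (K.identityˡ _))
    -- Whether `P` holds at `K.ε` need not be decided: a point of the preimage supplies a proof of
    -- it, and then all of `G` is a neighbourhood inside the preimage.
    (λ oP → G.locally-open λ _ p → _ , G.open-U , _ , λ _ → p)

  image-converges : (φ : ContinuousHom G K) {V : Set} {ι : V → G.Carrier} →
                    ConvergesTo1 G ι → ConvergesTo1 K (⟦ φ ⟧ ∘ ι)
  image-converges φ converges P oP pε =
    converges (P ∘ ⟦ φ ⟧) (φ.continuous oP) (K.open-resp-≈ oP (K.sym φ.ε-homo) pε)
    where module φ = ContinuousHom φ

  [,]-converges : ∀ {V W : Set} {φ : V → K.Carrier} {ψ : W → K.Carrier} →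
                  ConvergesTo1 K φ → ConvergesTo1 K ψ → ConvergesTo1 K Sum.[ φ , ψ ]
  [,]-converges conv conv′ P oP pε =
    let vs , v∈ = conv P oP pε ; ws , w∈ = conv′ P oP pε in
    map inj₁ vs ++ map inj₂ ws , λ
      { (inj₁ v) → Sum.map₁ (∈-++⁺ˡ ∘ ∈-map⁺ inj₁) (v∈ v)
      ; (inj₂ w) → Sum.map₁ (∈-++⁺ʳ (map inj₁ vs) ∘ ∈-map⁺ inj₂) (w∈ w)
      }

module _ {p : ℕ} {V W : Set} (F : FreeProP p V) (E : FreeProP p (V ⊎ W)) where
  freeInj₁-ι : ∀ v → FreeProP._≈_ E (⟦ freeInj₁ F E ⟧ (FreeProP.ι F v)) (FreeProP.ι E (inj₁ v))
  freeInj₁-ι = FreeProP.extend-ι F (FreeProP.proPGroup E) _ _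

module _ {p : ℕ} {V W : Set} (F : FreeProP p W) (E : FreeProP p (V ⊎ W)) where
  freeInj₂-ι : ∀ v → FreeProP._≈_ E (⟦ freeInj₂ F E ⟧ (FreeProP.ι F v)) (FreeProP.ι E (inj₂ v))
  freeInj₂-ι = FreeProP.extend-ι F (FreeProP.proPGroup E) _ _

-- The universal property of the amalgamated free pro-p product.

module AmalgamUniversal {p : ℕ} {H G₁ G₂ G : ProPGroup p} {P₁ : Presentation G₁} {P₂ : Presentation G₂}
         {f₁ : ContinuousHom (topologicalGroup H) (topologicalGroup G₁)}
         {f₂ : ContinuousHom (topologicalGroup H) (topologicalGroup G₂)}
         (A : Amalgam {H = H} P₁ P₂ f₁ f₂ G) (K : ProPGroup p) where
  private
    module H  = ProPGroup H
    module G₁ = ProPGroup G₁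
    module G₂ = ProPGroup G₂
    module G  = ProPGroup G
    module K  = ProPGroup K
    module P₁ = Presentation P₁
    module P₂ = Presentation P₂
    module F₁ = FreeProP P₁.F
    module F₂ = FreeProP P₂.F
    module A  = Amalgam A
    module E  = FreeProP A.E
    module π  = ContinuousHom A.π
    kTop = topologicalGroup K

    canonical₁-π : ∀ w → ⟦ A.canonical₁ ⟧ (⟦ P₁.π ⟧ w) G.≈ π.⟦ ⟦ freeInj₁ P₁.F A.E ⟧ w ⟧
    canonical₁-π = descend-π P₁.isPresentedBy G (A.π ∘ᶜ freeInj₁ P₁.F A.E)
      (relator-trivial A.isPresentedBy ∘ relator₁)

    canonical₂-π : ∀ w → ⟦ A.canonical₂ ⟧ (⟦ P₂.π ⟧ w) G.≈ π.⟦ ⟦ freeInj₂ P₂.F A.E ⟧ w ⟧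
    canonical₂-π = descend-π P₂.isPresentedBy G (A.π ∘ᶜ freeInj₂ P₂.F A.E)
      (relator-trivial A.isPresentedBy ∘ relator₂)

  -- Composed with `A.π`, both maps start at a free pro-p group, where it suffices to compare
  -- generators; each generator has its image in `canonical₁` or `canonical₂`.
  unique : (ψ χ : ContinuousHom G.topologicalGroup kTop) →
           (∀ x → ⟦ ψ ⟧ (⟦ A.canonical₁ ⟧ x) K.≈ ⟦ χ ⟧ (⟦ A.canonical₁ ⟧ x)) →
           (∀ x → ⟦ ψ ⟧ (⟦ A.canonical₂ ⟧ x) K.≈ ⟦ χ ⟧ (⟦ A.canonical₂ ⟧ x)) →
           ∀ x → ⟦ ψ ⟧ x K.≈ ⟦ χ ⟧ x
  unique ψ χ agree₁ agree₂ x =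
    let w , πw≈x = IsPresentedBy.surjective A.isPresentedBy x in begin
    ψ.⟦ x ⟧         ≈⟨ ψ.⟦⟧-cong πw≈x ⟨
    ψ.⟦ π.⟦ w ⟧ ⟧   ≈⟨ E.unique K (ψ ∘ᶜ A.π) (χ ∘ᶜ A.π) generators w ⟩
    χ.⟦ π.⟦ w ⟧ ⟧   ≈⟨ χ.⟦⟧-cong πw≈x ⟩
    χ.⟦ x ⟧         ∎
    where
    open SetoidReasoning K.setoid
    module ψ = ContinuousHom ψ
    module χ = ContinuousHom χ
    ι₁≈ : ∀ v → π.⟦ E.ι (inj₁ v) ⟧ G.≈ ⟦ A.canonical₁ ⟧ (⟦ P₁.π ⟧ (F₁.ι v))
    ι₁≈ v = G.trans (π.⟦⟧-cong (E.sym (freeInj₁-ι P₁.F A.E v))) (G.sym (canonical₁-π (F₁.ι v)))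
    ι₂≈ : ∀ v → π.⟦ E.ι (inj₂ v) ⟧ G.≈ ⟦ A.canonical₂ ⟧ (⟦ P₂.π ⟧ (F₂.ι v))
    ι₂≈ v = G.trans (π.⟦⟧-cong (E.sym (freeInj₂-ι P₂.F A.E v))) (G.sym (canonical₂-π (F₂.ι v)))
    generators : ∀ v → ψ.⟦ π.⟦ E.ι v ⟧ ⟧ K.≈ χ.⟦ π.⟦ E.ι v ⟧ ⟧
    generators (inj₁ v) = K.trans (ψ.⟦⟧-cong (ι₁≈ v)) (K.trans (agree₁ _) (χ.⟦⟧-cong (G.sym (ι₁≈ v))))
    generators (inj₂ v) = K.trans (ψ.⟦⟧-cong (ι₂≈ v)) (K.trans (agree₂ _) (χ.⟦⟧-cong (G.sym (ι₂≈ v))))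

  module _ (β₁ : ContinuousHom G₁.topologicalGroup kTop) (β₂ : ContinuousHom G₂.topologicalGroup kTop)
           (agree : ∀ h → ⟦ β₁ ⟧ (⟦ f₁ ⟧ h) K.≈ ⟦ β₂ ⟧ (⟦ f₂ ⟧ h)) where
    private
      module β₁ = ContinuousHom β₁
      module β₂ = ContinuousHom β₂

      conv = [,]-converges {G = kTop} {K = kTop}
        (image-converges (β₁ ∘ᶜ P₁.π) F₁.ι-converges) (image-converges (β₂ ∘ᶜ P₂.π) F₂.ι-converges)

      ψ : ContinuousHom E.topologicalGroup kTop
      ψ = E.extend K _ conv

      module ψ = ContinuousHom ψ

      ψ-freeInj₁ : ∀ w → ψ.⟦ ⟦ freeInj₁ P₁.F A.E ⟧ w ⟧ K.≈ β₁.⟦ ⟦ P₁.π ⟧ w ⟧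
      ψ-freeInj₁ = F₁.unique K (ψ ∘ᶜ freeInj₁ P₁.F A.E) (β₁ ∘ᶜ P₁.π) λ v →
        K.trans (ψ.⟦⟧-cong (freeInj₁-ι P₁.F A.E v)) (E.extend-ι K _ conv (inj₁ v))

      ψ-freeInj₂ : ∀ w → ψ.⟦ ⟦ freeInj₂ P₂.F A.E ⟧ w ⟧ K.≈ β₂.⟦ ⟦ P₂.π ⟧ w ⟧
      ψ-freeInj₂ = F₂.unique K (ψ ∘ᶜ freeInj₂ P₂.F A.E) (β₂ ∘ᶜ P₂.π) λ v →
        K.trans (ψ.⟦⟧-cong (freeInj₂-ι P₂.F A.E v)) (E.extend-ι K _ conv (inj₂ v))

      kills : ∀ {r} → AmalgamRelator {H = H} P₁ P₂ f₁ f₂ A.E r → ψ.⟦ r ⟧ K.≈ K.ε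
      kills (relator₁ {r} r∈R) = K.trans (ψ-freeInj₁ r)
        (K.trans (β₁.⟦⟧-cong (relator-trivial P₁.isPresentedBy r∈R)) β₁.ε-homo)
      kills (relator₂ {r} r∈R) = K.trans (ψ-freeInj₂ r)
        (K.trans (β₂.⟦⟧-cong (relator-trivial P₂.isPresentedBy r∈R)) β₂.ε-homo)
      kills (identify h {w₁} {w₂} e₁ e₂) = begin
        ψ.⟦ u₁ E.∙ u₂ E.⁻¹ ⟧                       ≈⟨ K.trans (ψ.homo _ _) (K.∙-congˡ (ψ.⁻¹-homo _)) ⟩
        ψ.⟦ u₁ ⟧ K.∙ ψ.⟦ u₂ ⟧ K.⁻¹                 ≈⟨ K.∙-cong (K.trans (ψ-freeInj₁ w₁) (β₁.⟦⟧-cong e₁))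
                                                       (K.⁻¹-cong (K.trans (ψ-freeInj₂ w₂) (β₂.⟦⟧-cong e₂))) ⟩
        β₁.⟦ ⟦ f₁ ⟧ h ⟧ K.∙ β₂.⟦ ⟦ f₂ ⟧ h ⟧ K.⁻¹   ≈⟨ K.∙-congʳ (agree h) ⟩
        β₂.⟦ ⟦ f₂ ⟧ h ⟧ K.∙ β₂.⟦ ⟦ f₂ ⟧ h ⟧ K.⁻¹   ≈⟨ K.inverseʳ _ ⟩
        K.ε                                        ∎
        where
        open SetoidReasoning K.setoid
        u₁ = ⟦ freeInj₁ P₁.F A.E ⟧ w₁
        u₂ = ⟦ freeInj₂ P₂.F A.E ⟧ w₂

    -- The mediating map of the pushout: on generators it is given by `β₁` and `β₂`, and `agree` is
    -- what kills the relators identifying the two copies of `H`.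
    glue : ContinuousHom G.topologicalGroup kTop
    glue = descend A.isPresentedBy K ψ kills

    private
      glue-π : ∀ w → ⟦ glue ⟧ π.⟦ w ⟧ K.≈ ψ.⟦ w ⟧
      glue-π = descend-π A.isPresentedBy K ψ kills

      module glue = ContinuousHom glue

    glue-canonical₁ : ∀ x → ⟦ glue ⟧ (⟦ A.canonical₁ ⟧ x) K.≈ β₁.⟦ x ⟧
    glue-canonical₁ x =
      let w , πw≈x = P₁.surjective x in begin
      glue.⟦ ⟦ A.canonical₁ ⟧ x ⟧              ≈⟨ glue.⟦⟧-cong (ContinuousHom.⟦⟧-cong A.canonical₁ πw≈x) ⟨
      glue.⟦ ⟦ A.canonical₁ ⟧ (⟦ P₁.π ⟧ w) ⟧   ≈⟨ glue.⟦⟧-cong (canonical₁-π w) ⟩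
      glue.⟦ π.⟦ ⟦ freeInj₁ P₁.F A.E ⟧ w ⟧ ⟧   ≈⟨ glue-π (⟦ freeInj₁ P₁.F A.E ⟧ w) ⟩
      ψ.⟦ ⟦ freeInj₁ P₁.F A.E ⟧ w ⟧            ≈⟨ ψ-freeInj₁ w ⟩
      β₁.⟦ ⟦ P₁.π ⟧ w ⟧                        ≈⟨ β₁.⟦⟧-cong πw≈x ⟩
      β₁.⟦ x ⟧                                 ∎
      where open SetoidReasoning K.setoid

    glue-canonical₂ : ∀ x → ⟦ glue ⟧ (⟦ A.canonical₂ ⟧ x) K.≈ β₂.⟦ x ⟧
    glue-canonical₂ x =
      let w , πw≈x = P₂.surjective x in begin
      glue.⟦ ⟦ A.canonical₂ ⟧ x ⟧              ≈⟨ glue.⟦⟧-cong (ContinuousHom.⟦⟧-cong A.canonical₂ πw≈x) ⟨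
      glue.⟦ ⟦ A.canonical₂ ⟧ (⟦ P₂.π ⟧ w) ⟧   ≈⟨ glue.⟦⟧-cong (canonical₂-π w) ⟩
      glue.⟦ π.⟦ ⟦ freeInj₂ P₂.F A.E ⟧ w ⟧ ⟧   ≈⟨ glue-π (⟦ freeInj₂ P₂.F A.E ⟧ w) ⟩
      ψ.⟦ ⟦ freeInj₂ P₂.F A.E ⟧ w ⟧            ≈⟨ ψ-freeInj₂ w ⟩
      β₂.⟦ ⟦ P₂.π ⟧ w ⟧                        ≈⟨ β₂.⟦⟧-cong πw≈x ⟩
      β₂.⟦ x ⟧                                 ∎
      where open SetoidReasoning K.setoid

-- The universal property of the pro-p HNN-extension.

module HNNUniversal {p : ℕ} {G₀ G : ProPGroup p} {P₀ : Presentation G₀}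
         {H : Pred (ProPGroup.Carrier G₀) 0ℓ} {H≤G₀ : ProPGroup.IsSubgroup G₀ H}
         {f : ContinuousHom (subgroup (topologicalGroup G₀) H H≤G₀) (topologicalGroup G₀)}
         (N : HNN P₀ H≤G₀ f G) where
  private
    module G₀ = ProPGroup G₀
    module G  = ProPGroup G
    module P₀ = Presentation P₀
    module F₀ = FreeProP P₀.F
    module N  = HNN N
    module E  = FreeProP N.E
    module π  = ContinuousHom N.π

    canonical-π : ∀ w → ⟦ N.canonical ⟧ (⟦ P₀.π ⟧ w) G.≈ π.⟦ ⟦ freeInj₁ P₀.F N.E ⟧ w ⟧
    canonical-π = descend-π P₀.isPresentedBy G (N.π ∘ᶜ freeInj₁ P₀.F N.E)
      (relator-trivial N.isPresentedBy ∘ relator)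

    module canonical = ContinuousHom N.canonical

  stable : G.Carrier
  stable = π.⟦ stableLetter P₀ H≤G₀ f N.E ⟧

  -- The relator t h t⁻¹ = f(h) rewritten without inverses, so that a 1-cochain can be evaluated on
  -- each side as on a product of two elements.
  stable-conjugates : ∀ h → stable G.∙ canonical.⟦ proj₁ h ⟧ G.≈ canonical.⟦ ⟦ f ⟧ h ⟧ G.∙ stable
  stable-conjugates h =
    let v , πv≈h  = P₀.surjective (proj₁ h)
        w , πw≈fh = P₀.surjective (⟦ f ⟧ h)
        t  = stableLetter P₀ H≤G₀ f N.E
        v′ = ⟦ freeInj₁ P₀.F N.E ⟧ v
        w′ = ⟦ freeInj₁ P₀.F N.E ⟧ w
        tvt⁻¹≈w : π.⟦ t E.∙ v′ E.∙ t E.⁻¹ ⟧ G.≈ π.⟦ w′ ⟧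
        tvt⁻¹≈w = GroupProperties.x∙y⁻¹≈ε⇒x≈y G.group _ _
          (G.trans (G.sym (G.trans (π.homo _ _) (G.∙-congˡ (π.⁻¹-homo w′))))
            (relator-trivial N.isPresentedBy (identify h {v} {w} πv≈h πw≈fh)))
    in begin
    stable G.∙ canonical.⟦ proj₁ h ⟧
      ≈⟨ G.∙-congˡ (G.trans (canonical.⟦⟧-cong (G₀.sym πv≈h)) (canonical-π v)) ⟩
    stable G.∙ π.⟦ v′ ⟧
      ≈⟨ π.homo t v′ ⟨
    π.⟦ t E.∙ v′ ⟧
      ≈⟨ GroupProperties.//-rightDividesˡ G.group stable _ ⟨
    π.⟦ t E.∙ v′ ⟧ G.∙ stable G.⁻¹ G.∙ stable
      ≈⟨ G.∙-congʳ (G.trans (G.∙-congˡ (G.sym (π.⁻¹-homo t))) (G.sym (π.homo _ _))) ⟩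
    π.⟦ t E.∙ v′ E.∙ t E.⁻¹ ⟧ G.∙ stable
      ≈⟨ G.∙-congʳ (G.trans tvt⁻¹≈w (G.trans (G.sym (canonical-π w)) (canonical.⟦⟧-cong πw≈fh))) ⟩
    canonical.⟦ ⟦ f ⟧ h ⟧ G.∙ stable ∎
    where open SetoidReasoning G.setoid

  module _ (K : ProPGroup p) where
    private
      module K = ProPGroup K
      kTop = topologicalGroup K

    unique : (ψ χ : ContinuousHom G.topologicalGroup kTop) →
             (∀ x → ⟦ ψ ⟧ canonical.⟦ x ⟧ K.≈ ⟦ χ ⟧ canonical.⟦ x ⟧) → ⟦ ψ ⟧ stable K.≈ ⟦ χ ⟧ stable →
             ∀ x → ⟦ ψ ⟧ x K.≈ ⟦ χ ⟧ x
    unique ψ χ agree agree-t x =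
      let w , πw≈x = IsPresentedBy.surjective N.isPresentedBy x in begin
      ψ.⟦ x ⟧         ≈⟨ ψ.⟦⟧-cong πw≈x ⟨
      ψ.⟦ π.⟦ w ⟧ ⟧   ≈⟨ E.unique K (ψ ∘ᶜ N.π) (χ ∘ᶜ N.π) generators w ⟩
      χ.⟦ π.⟦ w ⟧ ⟧   ≈⟨ χ.⟦⟧-cong πw≈x ⟩
      χ.⟦ x ⟧         ∎
      where
      open SetoidReasoning K.setoid
      module ψ = ContinuousHom ψ
      module χ = ContinuousHom χ
      ι≈ : ∀ v → π.⟦ E.ι (inj₁ v) ⟧ G.≈ canonical.⟦ ⟦ P₀.π ⟧ (F₀.ι v) ⟧
      ι≈ v = G.trans (π.⟦⟧-cong (E.sym (freeInj₁-ι P₀.F N.E v))) (G.sym (canonical-π (F₀.ι v)))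
      generators : ∀ v → ψ.⟦ π.⟦ E.ι v ⟧ ⟧ K.≈ χ.⟦ π.⟦ E.ι v ⟧ ⟧
      generators (inj₁ v)  = K.trans (ψ.⟦⟧-cong (ι≈ v)) (K.trans (agree _) (χ.⟦⟧-cong (G.sym (ι≈ v))))
      generators (inj₂ tt) = agree-t

    module _ (β : ContinuousHom G₀.topologicalGroup kTop) (s : K.Carrier)
             (conjugates : ∀ h → s K.∙ ⟦ β ⟧ (proj₁ h) K.∙ s K.⁻¹ K.≈ ⟦ β ⟧ (⟦ f ⟧ h)) where
      private
        module β = ContinuousHom β

        conv = [,]-converges {G = kTop} {K = kTop} {φ = ⟦ β ∘ᶜ P₀.π ⟧ ∘ F₀.ι} {ψ = λ (_ : ⊤) → s}
          -- A family with the single index `tt` converges to 1, its exceptional set being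
          -- everything.
          (image-converges (β ∘ᶜ P₀.π) F₀.ι-converges) (λ _ _ _ → tt ∷ [] , λ _ → inj₁ (here ≡.refl))

        ψ : ContinuousHom E.topologicalGroup kTop
        ψ = E.extend K _ conv

        module ψ = ContinuousHom ψ

        ψ-freeInj₁ : ∀ w → ψ.⟦ ⟦ freeInj₁ P₀.F N.E ⟧ w ⟧ K.≈ β.⟦ ⟦ P₀.π ⟧ w ⟧
        ψ-freeInj₁ = F₀.unique K (ψ ∘ᶜ freeInj₁ P₀.F N.E) (β ∘ᶜ P₀.π) λ v →
          K.trans (ψ.⟦⟧-cong (freeInj₁-ι P₀.F N.E v)) (E.extend-ι K _ conv (inj₁ v))

        kills : ∀ {r} → HNNRelator P₀ H≤G₀ f N.E r → ψ.⟦ r ⟧ K.≈ K.ε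
        kills (relator {r} r∈R) = K.trans (ψ-freeInj₁ r)
          (K.trans (β.⟦⟧-cong (relator-trivial P₀.isPresentedBy r∈R)) β.ε-homo)
        kills (identify h {v} {w} πv≈h πw≈fh) = begin
          ψ.⟦ t E.∙ v′ E.∙ t E.⁻¹ E.∙ w′ E.⁻¹ ⟧
            ≈⟨ K.trans (ψ.homo _ _) (K.∙-cong (K.trans (ψ.homo _ _) (K.∙-cong (ψ.homo _ _) (ψ.⁻¹-homo _))) (ψ.⁻¹-homo _)) ⟩
          ψ.⟦ t ⟧ K.∙ ψ.⟦ v′ ⟧ K.∙ ψ.⟦ t ⟧ K.⁻¹ K.∙ ψ.⟦ w′ ⟧ K.⁻¹
            ≈⟨ K.∙-cong (K.∙-cong (K.∙-cong ψt (K.trans (ψ-freeInj₁ v) (β.⟦⟧-cong πv≈h))) (K.⁻¹-cong ψt))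
                 (K.⁻¹-cong (K.trans (ψ-freeInj₁ w) (β.⟦⟧-cong πw≈fh))) ⟩
          s K.∙ β.⟦ proj₁ h ⟧ K.∙ s K.⁻¹ K.∙ β.⟦ ⟦ f ⟧ h ⟧ K.⁻¹
            ≈⟨ K.∙-congʳ (conjugates h) ⟩
          β.⟦ ⟦ f ⟧ h ⟧ K.∙ β.⟦ ⟦ f ⟧ h ⟧ K.⁻¹
            ≈⟨ K.inverseʳ _ ⟩
          K.ε ∎
          where
          open SetoidReasoning K.setoid
          t  = stableLetter P₀ H≤G₀ f N.E
          v′ = ⟦ freeInj₁ P₀.F N.E ⟧ v
          w′ = ⟦ freeInj₁ P₀.F N.E ⟧ w
          ψt : ψ.⟦ t ⟧ K.≈ s
          ψt = E.extend-ι K _ conv (inj₂ tt)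

      -- The map that is `β` on the base group and sends the stable letter to `s`; `conjugates`
      -- states that the HNN relators hold in `K`.
      glue : ContinuousHom G.topologicalGroup kTop
      glue = descend N.isPresentedBy K ψ kills

      private
        glue-π : ∀ w → ⟦ glue ⟧ π.⟦ w ⟧ K.≈ ψ.⟦ w ⟧
        glue-π = descend-π N.isPresentedBy K ψ kills

        module glue = ContinuousHom glue

      glue-canonical : ∀ x → ⟦ glue ⟧ canonical.⟦ x ⟧ K.≈ β.⟦ x ⟧
      glue-canonical x =
        let w , πw≈x = P₀.surjective x in begin
        glue.⟦ canonical.⟦ x ⟧ ⟧                 ≈⟨ glue.⟦⟧-cong (canonical.⟦⟧-cong πw≈x) ⟨
        glue.⟦ canonical.⟦ ⟦ P₀.π ⟧ w ⟧ ⟧        ≈⟨ glue.⟦⟧-cong (canonical-π w) ⟩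
        glue.⟦ π.⟦ ⟦ freeInj₁ P₀.F N.E ⟧ w ⟧ ⟧   ≈⟨ glue-π (⟦ freeInj₁ P₀.F N.E ⟧ w) ⟩
        ψ.⟦ ⟦ freeInj₁ P₀.F N.E ⟧ w ⟧            ≈⟨ ψ-freeInj₁ w ⟩
        β.⟦ ⟦ P₀.π ⟧ w ⟧                         ≈⟨ β.⟦⟧-cong πw≈x ⟩
        β.⟦ x ⟧                                  ∎
        where open SetoidReasoning K.setoid

-- H¹ as continuous homomorphisms to ℤ/p, and primitives of cup products.

module FirstCohomology (p : ℕ) (pr : Prime p) where
  open 𝔽-Cohomology p
  open CyclicGroup p pr
  open SetoidReasoning k.setoid

  infix 8 _⟨_⟩
  _⟨_⟩ : ∀ {G} → H G 1 → TopologicalGroup.Carrier G → ℤ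
  α ⟨ x ⟩ = H.fun α (x ∷ [])

  module _ {G : TopologicalGroup} where
    open TopologicalGroup G

    -- With trivial coefficients the coboundary of a 0-cochain is a difference of two equal values,
    -- so cohomologous 1-cocycles agree pointwise.
    ∼⇒≈ : ∀ (α β : H G 1) → α ∼ β → ∀ x → α ⟨ x ⟩ k.≈ β ⟨ x ⟩
    ∼⇒≈ _ _ (c , α-β≈dc) x = GroupProperties.x∙y⁻¹≈ε⇒x≈y k.+-group _ _
      (k.trans (α-β≈dc (x ∷ [])) (k.reflexive (dc≡0 (Cochain.fun c []))))
      where
      dc≡0 : ∀ a → a - (a - 0ℤ) ≡ 0ℤ
      dc≡0 = solve-∀

    ≈⇒∼ : ∀ (α β : H G 1) → (∀ x → α ⟨ x ⟩ k.≈ β ⟨ x ⟩) → α ∼ β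
    ≈⇒∼ α β e = H.cochain 0ᴴ , λ { (x ∷ []) → k.trans (k.+-congʳ { - (β ⟨ x ⟩)} (e x)) (k.-‿inverseʳ (β ⟨ x ⟩)) }

    additive⇒cocycle : (c : Cochain G 1) →
                       (∀ x y → Cochain.fun c (x ∙ y ∷ []) k.≈ Cochain.fun c (x ∷ []) + Cochain.fun c (y ∷ [])) →
                       H G 1
    additive⇒cocycle c c-additive = record
      { cochain = c
      ; cocycle = λ { (x ∷ y ∷ []) → let a = Cochain.fun c (x ∷ []) ; b = Cochain.fun c (y ∷ []) in
          k.trans (k.+-congˡ {b} (k.-‿cong (k.+-congʳ { - (a - 0ℤ)} (c-additive x y)))) (k.reflexive (lemma a b)) }
      }
      where
      lemma : ∀ a b → b - ((a + b) - (a - 0ℤ)) ≡ 0ℤ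
      lemma = solve-∀

    toHom : H G 1 → ContinuousHom G discrete
    toHom α = continuousHom (α ⟨_⟩) (λ e → H.cong α (e ∷ [])) (additive α) λ {P} oP → locally-open (nbhd oP)
      where
      nbhd : ∀ {P} → TopologicalGroup.IsOpen discrete P → ∀ x → P (α ⟨ x ⟩) →
             Σ[ Q ∈ Pred Carrier 0ℓ ] IsOpen Q × Q x × (∀ {y} → Q y → P (α ⟨ y ⟩))
      nbhd (lift resp) x px with H.continuous α (x ∷ [])
      ... | Q ∷ [] , oQ ∷ [] , qx ∷ [] , const = Q , oQ , qx , λ qy → resp (k.sym (const (qy ∷ []))) px

    fromHom : ContinuousHom G discrete → H G 1
    fromHom φ = additive⇒cocycle
      (record
        { fun        = λ { (x ∷ []) → φ.⟦ x ⟧ }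
        ; cong       = λ { (e ∷ []) → φ.⟦⟧-cong e }
        ; continuous = λ { (x ∷ []) → (λ y → φ.⟦ y ⟧ k.≈ φ.⟦ x ⟧) ∷ []
            , φ.continuous (lift λ e f → k.trans (k.sym e) f) ∷ [] , k.refl ∷ [] , λ { (e ∷ []) → e } }
        })
      φ.homo
      where module φ = ContinuousHom φ

    module _ (α β : H G 1) (α⌣β∼0 : α ⌣ β ∼ 0ᴴ) where
      private c = proj₁ α⌣β∼0

      -- The equation α(x) β(y) = c(y) - c(xy) + c(x), solved for c(xy): the cup product measures
      -- how far its primitive `c` is from being additive.
      cup-primitive : ∀ x y → Cochain.fun c (x ∙ y ∷ []) k.≈
                      (Cochain.fun c (x ∷ []) + Cochain.fun c (y ∷ [])) - α ⟨ x ⟩ * β ⟨ y ⟩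
      cup-primitive x y = begin
        cxy                                        ≈⟨ k.reflexive (lemma cx cy cxy) ⟩
        (cx + cy) - (cy - (cxy - (cx - 0ℤ)))       ≈⟨ k.+-congˡ {cx + cy} (k.-‿cong (proj₂ α⌣β∼0 (x ∷ y ∷ []))) ⟨
        (cx + cy) - (α ⟨ x ⟩ * β ⟨ y ⟩ - 0ℤ)       ≈⟨ k.reflexive (lemma′ (cx + cy) (α ⟨ x ⟩ * β ⟨ y ⟩)) ⟩
        (cx + cy) - α ⟨ x ⟩ * β ⟨ y ⟩              ∎
        where
        cx  = Cochain.fun c (x ∷ [])
        cy  = Cochain.fun c (y ∷ [])
        cxy = Cochain.fun c (x ∙ y ∷ [])
        lemma : ∀ a b c → c ≡ (a + b) - (b - (c - (a - 0ℤ)))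
        lemma = solve-∀
        lemma′ : ∀ a b → a - (b - 0ℤ) ≡ a - b
        lemma′ = solve-∀

    -- Every `α` in ℛ is zero, hence the corestriction of the zero class, which lies in ℛ of the
    -- subgroup.
    ℛ-Trivial⇒KijimaNishi : ℛ-Trivial G → KijimaNishi G
    ℛ-Trivial⇒KijimaNishi trivial N≤G N-open _ index α α∈ℛ = 0ᴴ ,
      (λ β → H.cochain 0ᴴ , λ { (x ∷ y ∷ []) → k.reflexive (lemma (β ⟨ y ⟩)) }) ,
      ≈⇒∼ (cor N≤G N-open index 0ᴴ) α λ x → k.trans (sum-replicate-zero p) (k.sym (∼⇒≈ α 0ᴴ (trivial α α∈ℛ) x))
      where
      open CommutativeMonoidSum k.+-commutativeMonoid using (sum-replicate-zero)
      lemma : ∀ b → 0ℤ * b - 0ℤ ≡ 0ℤ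
      lemma = solve-∀

  module _ {G K : TopologicalGroup} (φ : ContinuousHom G K) where
    private
      module G = TopologicalGroup G
      module K = TopologicalGroup K
      module φ = ContinuousHom φ

    pullback-fromHom : ∀ (ψ : ContinuousHom K discrete) (β : H G 1) →
                       (∀ x → ⟦ ψ ⟧ φ.⟦ x ⟧ k.≈ β ⟨ x ⟩) → pullback φ (fromHom ψ) ∼ β
    pullback-fromHom ψ β = ≈⇒∼ (pullback φ (fromHom ψ)) β

    -- Stated for cochains rather than classes, because a primitive of a cup product is in general
    -- not a cocycle.
    pullbackCochain : Cochain K 1 → Cochain G 1
    pullbackCochain c = record
      { fun        = λ { (x ∷ []) → c.fun (φ.⟦ x ⟧ ∷ []) }
      ; cong       = λ { (e ∷ []) → c.cong (φ.⟦⟧-cong e ∷ []) }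
      ; continuous = continuous
      }
      where
      module c = Cochain c
      continuous : ∀ xs → _
      continuous (x ∷ []) with c.continuous (φ.⟦ x ⟧ ∷ [])
      ... | P ∷ [] , oP ∷ [] , px ∷ [] , const =
        (P ∘ φ.⟦_⟧) ∷ [] , φ.continuous oP ∷ [] , px ∷ [] , λ { {_ ∷ []} (py ∷ []) → const (py ∷ []) }

    -- A given `β` on `G` is the pullback of some `β′` on `K`; a primitive of `α ⌣ β′` then pulls
    -- back to a primitive for the restriction of `α` and `β`.
    res-ℛ : StrictlySurjective _∼_ (pullback φ {1}) → ∀ α → α ∈ ℛ K → pullback φ α ∈ ℛ G
    res-ℛ surjective α α∈ℛ β =
      let β′ , resβ′∼β = surjective β
          c , α⌣β′≈dc  = α∈ℛ β′
      in pullbackCochain c , λ { (x ∷ y ∷ []) → begin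
        α ⟨ φ.⟦ x ⟧ ⟩ * β ⟨ y ⟩ - 0ℤ
          ≈⟨ k.+-congʳ { - 0ℤ} (k.*-congˡ {α ⟨ φ.⟦ x ⟧ ⟩} (∼⇒≈ (pullback φ β′) β resβ′∼β y)) ⟨
        α ⟨ φ.⟦ x ⟧ ⟩ * β′ ⟨ φ.⟦ y ⟧ ⟩ - 0ℤ
          ≈⟨ α⌣β′≈dc (φ.⟦ x ⟧ ∷ φ.⟦ y ⟧ ∷ []) ⟩
        Cochain.fun c (φ.⟦ y ⟧ ∷ []) - (Cochain.fun c (φ.⟦ x ⟧ K.∙ φ.⟦ y ⟧ ∷ []) - (Cochain.fun c (φ.⟦ x ⟧ ∷ []) - 0ℤ))
          ≈⟨ k.+-congˡ {Cochain.fun c (φ.⟦ y ⟧ ∷ [])} (k.-‿cong (k.+-congʳ { - (Cochain.fun c (φ.⟦ x ⟧ ∷ []) - 0ℤ)}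
               (Cochain.cong c (φ.homo x y ∷ [])))) ⟨
        Cochain.fun c (φ.⟦ y ⟧ ∷ []) - (Cochain.fun c (φ.⟦ x G.∙ y ⟧ ∷ []) - (Cochain.fun c (φ.⟦ x ⟧ ∷ []) - 0ℤ)) ∎ }

    res-trivial : StrictlySurjective _∼_ (pullback φ {1}) → ℛ-Trivial G →
                  ∀ α → α ∈ ℛ K → ∀ x → α ⟨ φ.⟦ x ⟧ ⟩ k.≈ 0ℤ
    res-trivial surjective trivial α α∈ℛ =
      ∼⇒≈ (pullback φ α) 0ᴴ (trivial (pullback φ α) (res-ℛ surjective α α∈ℛ))

  -- Nonzero first cohomology of a nontrivial subgroup of a pro-p group.

  module _ (G : ProPGroup p) {H₀ : Pred (ProPGroup.Carrier G) 0ℓ} (H≤G : ProPGroup.IsSubgroup G H₀) where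
    private
      module G = ProPGroup G
      S = subgroup G.topologicalGroup H₀ H≤G
      module S = TopologicalGroup S

    -- An open normal `N` of p-power index separates `h` from 1, so H/(N ∩ H) is nontrivial of order
    -- dividing a power of `p`. A nontrivial homomorphism from it to ℤ/p inflates to H.
    nontrivial-H¹ : ∀ {h} → H₀ h → ¬ h G.≈ G.ε → ¬ (∀ (χ : H S 1) x → χ ⟨ x ⟩ k.≈ 0ℤ)
    nontrivial-H¹ {h} h∈H h≉ε trivial =
      let _ , _ , _ , oQ , ph , qε , disjoint = G.hausdorff h G.ε h≉ε
          N , oN , N≤G , N-normal , (l , index) , N⊆Q = G.basis oQ qε
      -- The goal is empty, so an index known only up to double negation may be used.
      in ¬¬-subgroup-index G.topologicalGroup N≤G N-normal index H≤G λ (m , indexᴴ , m∣p^l) →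
           contradict N oN N≤G N-normal (λ nh → disjoint ph (N⊆Q nh)) m indexᴴ l m∣p^l
      where
      contradict : ∀ N → G.IsOpen N → (N≤G : G.IsSubgroup N) → G.IsNormal N → ¬ N h →
                   ∀ m → S.Index (N ∘ proj₁) m → ∀ l → m ∣ p ^ l → _
      contradict N oN N≤G N-normal h∉N zero    index l m∣ with () ← S.Index.coset index (h , h∈H)
      -- There is at least one coset, that of `h`.
      contradict N oN N≤G N-normal h∉N (suc m) index l m∣ =
        nontrivial-homo Q.isGroupᶠ A.isGroupᶠ {k = l} pr m∣ ∣-refl {x = Q.coset (h , h∈H)} h̄≢ε φ-trivial
        where
        N∩H≤H : S.IsSubgroup (N ∘ proj₁)
        N∩H≤H = record { resp-≈ = N.resp-≈ ; ε-closed = N.ε-closed ; ∙-closed = N.∙-closed ; ⁻¹-closed = N.⁻¹-closed }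
          where module N = G.IsSubgroup N≤G

        module Q = FiniteQuotient S N∩H≤H (λ (g , _) → N-normal g) index
        -- ℤ/p as a group on `Fin p`: the quotient of `discrete` by the integers congruent to 0.
        module A = FiniteQuotient discrete zeros-isSubgroup zeros-isNormal residue-index

        h̄≢ε : Q.coset (h , h∈H) ≢ Q.εᶠ
        h̄≢ε e = h∉N (G.IsSubgroup.resp-≈ N≤G
          (G.trans (G.∙-congʳ (GroupProperties.ε⁻¹≈ε G.group)) (G.identityˡ h)) (Q.coset-≡⇒N (≡.sym e)))

        module _ (φ : Fin (suc m) → Fin p) (φ-homo : ∀ i j → φ (i Q.∙ᶠ j) ≡ φ i A.∙ᶠ φ j) where
          -- The inflation of `φ` along H → H/(N ∩ H), with residues read as integers.
          χ : H S 1
          χ = fromHom (continuousHom (A.rep ∘ φ ∘ Q.coset)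
            (λ {x} {y} e → k.reflexive (≡.cong (A.rep ∘ φ) (Q.coset-cong {x} {y} e)))
            (λ x y → k.trans (k.reflexive (≡.cong A.rep (≡.trans (≡.cong φ (Q.coset-∙ x y)) (φ-homo _ _)))) (k.sym (≈-residue _)))
            -- Continuity: the map is constant on the cosets of N ∩ H, which are open in H.
            λ {P} oP → S.locally-open {P ∘ A.rep ∘ φ ∘ Q.coset} λ (x , hx) px →
              (λ (y , _) → N (x G.⁻¹ G.∙ y))
              , (_ , G.open-translateˡ (x G.⁻¹) oN , id , id)
              , G.IsSubgroup.resp-≈ N≤G (G.sym (G.inverseˡ x)) (G.IsSubgroup.ε-closed N≤G)
              , λ {y} n → ≡.subst (P ∘ A.rep ∘ φ) (Q.N⇒coset-≡ {x , hx} {y} n) px)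

          φ-trivial : ∀ i → φ i ≡ A.εᶠ
          φ-trivial i = ≡.trans (≡.cong φ (≡.sym (Q.coset-rep i)))
            (≡.trans (≡.sym (A.coset-rep _)) (A.coset-cong (trivial χ (Q.rep i))))

  -- Amalgamated products.

  module _ {H₀ G₁ G₂ G : ProPGroup p} {P₁ : Presentation G₁} {P₂ : Presentation G₂}
           {f₁ : ContinuousHom (topologicalGroup H₀) (topologicalGroup G₁)}
           {f₂ : ContinuousHom (topologicalGroup H₀) (topologicalGroup G₂)}
           (A : Amalgam {H = H₀} P₁ P₂ f₁ f₂ G)
           (res₁-surjective : StrictlySurjective _∼_ (pullback f₁ {1}))
           (res₂-surjective : StrictlySurjective _∼_ (pullback f₂ {1})) where
    private
      module A = Amalgam A
    open AmalgamUniversal A proPGroup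

    -- Surjectivity of restriction from `G₂` to `H₀` yields a class `β₂` that agrees with `β₁` on
    -- `H₀`; the two glue to a class on `G`.
    canonical₁-surjective : StrictlySurjective _∼_ (pullback A.canonical₁ {1})
    canonical₁-surjective β₁ =
      let β₂ , agree = res₂-surjective (pullback f₁ β₁)
          compatible = λ h → k.sym (∼⇒≈ (pullback f₂ β₂) (pullback f₁ β₁) agree h)
      in fromHom (glue (toHom β₁) (toHom β₂) compatible)
       , pullback-fromHom A.canonical₁ _ β₁ (glue-canonical₁ (toHom β₁) (toHom β₂) compatible)

    canonical₂-surjective : StrictlySurjective _∼_ (pullback A.canonical₂ {1})
    canonical₂-surjective β₂ =
      let β₁ , agree = res₁-surjective (pullback f₂ β₂)
          compatible = ∼⇒≈ (pullback f₁ β₁) (pullback f₂ β₂) agree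
      in fromHom (glue (toHom β₁) (toHom β₂) compatible)
       , pullback-fromHom A.canonical₂ _ β₂ (glue-canonical₂ (toHom β₁) (toHom β₂) compatible)

    -- A class in ℛ restricts to ℛ of each factor, hence to zero, and a homomorphism on `G` is
    -- determined by its two restrictions.
    amalgam-ℛ-Trivial : ℛ-Trivial (topologicalGroup G₁) → ℛ-Trivial (topologicalGroup G₂) →
                        ℛ-Trivial (topologicalGroup G)
    amalgam-ℛ-Trivial trivial₁ trivial₂ α α∈ℛ = ≈⇒∼ α 0ᴴ (unique (toHom α) trivialHom
      (res-trivial A.canonical₁ canonical₁-surjective trivial₁ α α∈ℛ)
      (res-trivial A.canonical₂ canonical₂-surjective trivial₂ α α∈ℛ))

  -- HNN-extensions.

  module _ {G₀ G : ProPGroup p} {P₀ : Presentation G₀} {H₀ : Pred (ProPGroup.Carrier G₀) 0ℓ}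
           {H≤G₀ : ProPGroup.IsSubgroup G₀ H₀}
           {f : ContinuousHom (subgroup (topologicalGroup G₀) H₀ H≤G₀) (topologicalGroup G₀)}
           (E : HNN P₀ H≤G₀ f G)
           (f*-res : (β : H (topologicalGroup G₀) 1) → pullback (toImage f) (res (image-isSubgroup f) β) ∼ res H≤G₀ β)
           (res-surjective : StrictlySurjective _∼_ (res {topologicalGroup G₀} {1} H≤G₀)) where
    private
      module E = HNN E
      module G = ProPGroup G
      module G₀ = ProPGroup G₀
    open HNNUniversal E

    f-invariant : ∀ (β : H G₀.topologicalGroup 1) h → β ⟨ ⟦ f ⟧ h ⟩ k.≈ β ⟨ proj₁ h ⟩
    f-invariant β = ∼⇒≈ (pullback (toImage f) (res (image-isSubgroup f) β)) (res H≤G₀ β) (f*-res β)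

    -- In the abelian group ℤ/p conjugation does nothing, so the HNN relation only asks that β(f(h))
    -- = β(h). The stable letter may therefore be sent to 0.
    trivially-conjugates : ∀ (β : H G₀.topologicalGroup 1) h → 0ℤ + β ⟨ proj₁ h ⟩ + - 0ℤ k.≈ β ⟨ ⟦ f ⟧ h ⟩
    trivially-conjugates β h = k.trans (k.reflexive (lemma (β ⟨ proj₁ h ⟩))) (k.sym (f-invariant β h))
      where
      lemma : ∀ b → 0ℤ + b + - 0ℤ ≡ b
      lemma = solve-∀

    extendBy0 : H G₀.topologicalGroup 1 → ContinuousHom G.topologicalGroup discrete
    extendBy0 β = glue proPGroup (toHom β) 0ℤ (trivially-conjugates β)

    extendBy0-canonical : ∀ β x → ⟦ extendBy0 β ⟧ (⟦ E.canonical ⟧ x) k.≈ β ⟨ x ⟩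
    extendBy0-canonical β = glue-canonical proPGroup (toHom β) 0ℤ (trivially-conjugates β)

    canonical-surjective : StrictlySurjective _∼_ (pullback E.canonical {1})
    canonical-surjective β = fromHom (extendBy0 β) , pullback-fromHom E.canonical (extendBy0 β) β (extendBy0-canonical β)

    -- If d c = α ⌣ β, then c is additive on G₀ because α vanishes there, so c(f h) = c(h);
    -- evaluating c on t h = f(h) t then gives α(t) β(h) = 0.
    stable-annihilates : ∀ (α β : H G.topologicalGroup 1) → (∀ x → α ⟨ ⟦ E.canonical ⟧ x ⟩ k.≈ 0ℤ) →
                         α ⌣ β ∼ 0ᴴ → ∀ h → α ⟨ stable ⟩ * β ⟨ ⟦ E.canonical ⟧ (proj₁ h) ⟩ k.≈ 0ℤ
    stable-annihilates α β α₀≈0 α⌣β∼0@(c₁ , _) h = begin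
      α ⟨ stable ⟩ * β ⟨ x ⟩
        ≈⟨ k.reflexive (lemma (c stable) (c x) _) ⟩
      (c stable + c x) - ((c stable + c x) - α ⟨ stable ⟩ * β ⟨ x ⟩)
        ≈⟨ k.+-congˡ {c stable + c x} (k.-‿cong (cup-primitive α β α⌣β∼0 stable x)) ⟨
      (c stable + c x) - c (stable G.∙ x)
        ≈⟨ k.+-congˡ {c stable + c x} (k.-‿cong (Cochain.cong c₁ (stable-conjugates h ∷ []))) ⟩
      (c stable + c x) - c (y G.∙ stable)
        ≈⟨ k.+-congˡ {c stable + c x} (k.-‿cong (cup-primitive α β α⌣β∼0 y stable)) ⟩
      (c stable + c x) - ((c y + c stable) - α ⟨ y ⟩ * β ⟨ stable ⟩)
        ≈⟨ k.+-congˡ {c stable + c x} (k.-‿cong (k.+-cong (k.+-congʳ {c stable} (f-invariant c₀ h))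
             (k.-‿cong (k.*-congʳ {β ⟨ stable ⟩} (α₀≈0 (⟦ f ⟧ h)))))) ⟩
      (c stable + c x) - ((c x + c stable) - 0ℤ * β ⟨ stable ⟩)
        ≈⟨ k.reflexive (lemma′ (c stable) (c x) (β ⟨ stable ⟩)) ⟩
      0ℤ ∎
      where
      c : G.Carrier → ℤ
      c z = Cochain.fun c₁ (z ∷ [])

      x = ⟦ E.canonical ⟧ (proj₁ h)
      y = ⟦ E.canonical ⟧ (⟦ f ⟧ h)

      lemma : ∀ a b m → m ≡ (a + b) - ((a + b) - m)
      lemma = solve-∀
      lemma′ : ∀ a b m → (a + b) - ((b + a) - 0ℤ * m) ≡ 0ℤ
      lemma′ = solve-∀
      lemma″ : ∀ a b → a - 0ℤ * b ≡ a
      lemma″ = solve-∀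

      c-additive : ∀ u v → c (⟦ E.canonical ⟧ (u G₀.∙ v)) k.≈ c (⟦ E.canonical ⟧ u) + c (⟦ E.canonical ⟧ v)
      c-additive u v = begin
        c (⟦ E.canonical ⟧ (u G₀.∙ v))                 ≈⟨ Cochain.cong c₁ (ContinuousHom.homo E.canonical u v ∷ []) ⟩
        c (u′ G.∙ v′)                                  ≈⟨ cup-primitive α β α⌣β∼0 u′ v′ ⟩
        (c u′ + c v′) - α ⟨ u′ ⟩ * β ⟨ v′ ⟩            ≈⟨ k.+-congˡ {c u′ + c v′} (k.-‿cong (k.*-congʳ {β ⟨ v′ ⟩} (α₀≈0 u))) ⟩
        (c u′ + c v′) - 0ℤ * β ⟨ v′ ⟩                  ≈⟨ k.reflexive (lemma″ (c u′ + c v′) (β ⟨ v′ ⟩)) ⟩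
        c u′ + c v′                                    ∎
        where
        u′ = ⟦ E.canonical ⟧ u
        v′ = ⟦ E.canonical ⟧ v

      c₀ : H G₀.topologicalGroup 1
      c₀ = additive⇒cocycle (pullbackCochain E.canonical c₁) c-additive

    -- Once `α` vanishes on the base group, only its value at the stable letter matters; were that
    -- nonzero, every class on the subgroup would vanish, against `nontrivial-H¹`.
    hnn-ℛ-Trivial : ∀ {h} → H₀ h → ¬ h G₀.≈ G₀.ε → ℛ-Trivial G₀.topologicalGroup → ℛ-Trivial G.topologicalGroup
    hnn-ℛ-Trivial h∈H h≉ε trivial₀ α α∈ℛ =
      ≈⇒∼ α 0ᴴ (unique proPGroup (toHom α) trivialHom α₀≈0 α-stable≈0)
      where
      α₀≈0 : ∀ x → α ⟨ ⟦ E.canonical ⟧ x ⟩ k.≈ 0ℤ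
      α₀≈0 = res-trivial E.canonical canonical-surjective trivial₀ α α∈ℛ

      -- Extend `χ` first to the base group and then to `G`; the product of its values with α(t) is
      -- 0, and α(t) can be cancelled since `p` is prime.
      χ≈0 : ¬ α ⟨ stable ⟩ k.≈ 0ℤ → ∀ (χ : H (subgroup G₀.topologicalGroup H₀ H≤G₀) 1) h → χ ⟨ h ⟩ k.≈ 0ℤ
      χ≈0 α-stable≉0 χ h =
        let β₀ , resβ₀∼χ = res-surjective χ
            β  , resβ∼β₀ = canonical-surjective β₀
        in begin
        χ ⟨ h ⟩                           ≈⟨ ∼⇒≈ (res H≤G₀ β₀) χ resβ₀∼χ h ⟨
        β₀ ⟨ proj₁ h ⟩                    ≈⟨ ∼⇒≈ (pullback E.canonical β) β₀ resβ∼β₀ (proj₁ h) ⟨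
        β ⟨ ⟦ E.canonical ⟧ (proj₁ h) ⟩   ≈⟨ Sum.[ (λ e → contradiction e α-stable≉0) , id ]
                                               (zeroDivisor {α ⟨ stable ⟩} (stable-annihilates α β α₀≈0 (α∈ℛ β) h)) ⟩
        0ℤ                                ∎

      α-stable≈0 : α ⟨ stable ⟩ k.≈ 0ℤ
      α-stable≈0 = decidable-stable (≈0? (α ⟨ stable ⟩)) λ α-stable≉0 →
        nontrivial-H¹ G₀ H≤G₀ h∈H h≉ε (χ≈0 α-stable≉0)

-- The two constructions combined, with the Kijima-Nishi property as a consequence.

theorem3 :
  (p : ℕ) → Prime p → (G₀ G₁ G₂ : ProPGroup p) →
  let open 𝔽-Cohomology p in
  ℛ-Trivial (topologicalGroup G₀) →
  ℛ-Trivial (topologicalGroup G₁) →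
  ℛ-Trivial (topologicalGroup G₂) →
  (G : ProPGroup p) →
  ( (Σ[ H₀ ∈ ProPGroup p ]
     Σ[ f₁ ∈ ContinuousHom (topologicalGroup H₀) (topologicalGroup G₁) ]
     Σ[ f₂ ∈ ContinuousHom (topologicalGroup H₀) (topologicalGroup G₂) ]
     Σ[ P₁ ∈ Presentation G₁ ] Σ[ P₂ ∈ Presentation G₂ ]
     Σ[ A ∈ Amalgam {H = H₀} P₁ P₂ f₁ f₂ G ]
       IsInjective f₁ × IsInjective f₂ × Amalgam.IsProper A
       × StrictlySurjective _∼_ (pullback f₁ {1})
       × StrictlySurjective _∼_ (pullback f₂ {1}))
  ⊎ (Σ[ H₀ ∈ Pred (ProPGroup.Carrier G₀) 0ℓ ]
     Σ[ H≤G₀ ∈ ProPGroup.IsSubgroup G₀ H₀ ]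
     Σ[ f ∈ ContinuousHom (subgroup (topologicalGroup G₀) H₀ H≤G₀) (topologicalGroup G₀) ]
     Σ[ P₀ ∈ Presentation G₀ ]
     Σ[ E ∈ HNN P₀ H≤G₀ f G ]
       ProPGroup.IsClosed G₀ H₀
       -- H ≠ 1: for H = 1 one has G = G₀ ⨿ ℤₚ, and the dual of the stable letter
       -- is a nonzero element of ℛₚ(G).
       × (∃ λ h → H₀ h × ¬ ProPGroup._≈_ G₀ h (ProPGroup.ε G₀))
       × IsInjective f × HNN.IsProper E
       × ((α : H (topologicalGroup G₀) 1) →
            pullback (toImage f) (res (image-isSubgroup f) α) ∼ res H≤G₀ α)
       × StrictlySurjective _∼_ (res {topologicalGroup G₀} {1} H≤G₀)) ) →
  ℛ-Trivial (topologicalGroup G) × KijimaNishi (topologicalGroup G)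
theorem3 p pr G₀ G₁ G₂ trivial₀ trivial₁ trivial₂ G decomposition =
  ℛ-trivial decomposition , ℛ-Trivial⇒KijimaNishi (ℛ-trivial decomposition)
  where
  open FirstCohomology p pr
  ℛ-trivial : _ → _
  ℛ-trivial (inj₁ (_ , _ , _ , _ , _ , A , _ , _ , _ , res₁-surjective , res₂-surjective)) =
    amalgam-ℛ-Trivial A res₁-surjective res₂-surjective trivial₁ trivial₂
  ℛ-trivial (inj₂ (_ , _ , _ , _ , E , _ , (h , h∈H , h≉ε) , _ , _ , f*-res , res-surjective)) =
    hnn-ℛ-Trivial E f*-res res-surjective h∈H h≉ε trivial₀
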